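{- For every $n\ge 1$, every $0<\varepsilon\le 1$, and every input $\{w_1,\dots,w_n\}$, $C$ to the 0/1 Knapsack counting problem, one can (deterministically) compute a floating-point number $Z$ of $2\log n+\log(1/\varepsilon)+1$ bits which satisfies $$(1-\varepsilon)\,s(n,C)\le Z\le s(n,C),$$ in time $$O\!\left(n^3\varepsilon^{ -1}\left\lceil \frac{\log(1/\varepsilon)}{\log n}\right\rceil\right),$$ assuming unit cost additions and comparisons on numbers with $O(\log C)$ bits.
   Context: An input to the 0/1 Knapsack counting problem consists of $n$ nonnegative integer weights $w_1,\dots,w_n$ and an integer capacity $C$; $s(n,C)$ is the number of solutions, that is, the number of subsets of the $n$ items whose weights sum up to at most $C$. A floating-point number consists of an exponent $p$ and a mantissa of bits $x_1x_2\dots x_t$, and represents the value $2^p(x_1 2^{ -1}+\dots+x_t2^{ -t})$; here $\log n$ bits are used for the exponent and $t=1+\log(n/\varepsilon)$ bits for the mantissa. Logarithms are base 2.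
   Formalization: ε ranges over rationals in (0,1] rather than reals; the factor ⌈log(1/ε)/log n⌉ is read as at least 1 (ε = 1) and log n as 1 when n = 1, where the formula is degenerate or undefined. In the time bound, the factor ⌈log(1/ε)/log n⌉ is read as at least 1 (for ε = 1 it would be 0, giving the impossible time O(0)), and log n is read as 1 when n = 1 (where the quotient is undefined); ε is rational, and bit counts are rounded up. -}

module Defs where

open import Data.Bool.Base using (Bool; true; false; if_then_else_)
open import Data.Fin.Subset using (Subset; inside; outside)
open import Data.Integer.Base as ℤ using (ℤ; +_; -[1+_])
import Data.Integer.Properties as ℤ
open import Data.List.Base using (List; []; _∷_; _++_; map; length; filter)
open import Data.Nat.Base
open import Data.Nat.DivMod using (_/_; _%_)
open import Data.Nat.Logarithm using (⌊log₂_⌋)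
open import Data.Nat.Properties using (m^n≢0)
open import Data.Product.Base using (_×_; ∃-syntax)
open import Data.Rational.Base as ℚ using (ℚ; ½; 0ℚ; 1ℚ; 1/_; ↥_; ↧ₙ_; ceiling)
import Data.Rational.Properties as ℚ
open import Data.Vec.Base as Vec using (Vec; []; _∷_; zipWith)
open import Relation.Binary.PropositionalEquality.Core using (_≡_)
open import Relation.Nullary.Decidable.Core using (does)

------------------------------------------------------------------------
-- Counting knapsack solutions

weight : ∀ {n} → Vec ℕ n → Subset n → ℕ
weight w S = Vec.sum (zipWith (λ wᵢ i∈S → if i∈S then wᵢ else 0) w S)

subsets : ∀ n → List (Subset n)
subsets zero    = [] ∷ []
subsets (suc n) = map (outside ∷_) (subsets n) ++ map (inside ∷_) (subsets n)

#solutions : ∀ {n} → Vec ℕ n → ℤ → ℕ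
#solutions {n} w C = length (filter (λ S → + weight w S ℤ.≤? C) (subsets n))

------------------------------------------------------------------------
-- Rationals and logarithms

fromℕ : ℕ → ℚ
fromℕ m = + m ℚ./ 1

recip : (q : ℚ) → .{{ℚ.Positive q}} → ℚ
recip q = (1/ q) {{ℚ.pos⇒nonZero q}}

leastBelow : ℕ → (ℕ → Bool) → ℕ
leastBelow zero    p = zero
leastBelow (suc m) p = if p zero then zero else suc (leastBelow m (λ k → p (suc k)))

-- The ceiling of the real number log_b q, for b ≥ 2 and q ≥ 1: the least k
-- with q ≤ b ^ k.  The search stops at the ceiling of q, which is enough as b ^ m ≥ m.
⌈log[_]_⌉ : ℕ → ℚ → ℕ
⌈log[ b ] q ⌉ = leastBelow ℤ.∣ ceiling q ∣ (λ k → does (q ℚ.≤? fromℕ (b ^ k)))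

------------------------------------------------------------------------
-- Floating-point numbers

unsigned : ∀ {k} → Vec Bool k → ℕ
unsigned []               = 0
unsigned {suc k} (b ∷ bs) = (if b then 2 ^ k else 0) + unsigned bs

-- x₁ 2⁻¹ + … + x_t 2⁻ᵗ
fraction : ∀ {t} → Vec Bool t → ℚ
fraction []       = 0ℚ
fraction (x ∷ xs) = ½ ℚ.* ((if x then 1ℚ else 0ℚ) ℚ.+ fraction xs)

record Float (e t : ℕ) : Set where
  constructor float
  field
    exponentBits : Vec Bool e
    mantissa     : Vec Bool t

  -- The e exponent bits encode the 2 ^ e exponents 1, …, 2 ^ e.  Starting at 0
  -- would make log n bits too few when n is a power of 2: the largest exponent
  -- would be n ∸ 1, but counts up to 2 ^ n have to be approximated.
  exponent : ℕ
  exponent = suc (unsigned exponentBits)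

  value : ℚ
  value = fromℕ (2 ^ exponent) ℚ.* fraction mantissa

------------------------------------------------------------------------
-- A random access machine with registers and arrays of natural numbers.
-- A program uses finitely many registers and arrays, all named by literals.

data Loc : Set where
  reg : ℕ → Loc
  arr : ℕ → ℕ → Loc       -- arr a r : the cell of array a whose index is in register r

data Operand : Set where
  lit : ℕ → Operand
  at  : Loc → Operand

data Op : Set where
  add sub shl shr : Op

data Cmp : Set where
  lt le eq : Cmp

record Test : Set where
  constructor test
  field
    cmp         : Cmp
    left right  : Operand

infixr 4 _⨾_
infix  5 _≔_[_,_]

data Program : Set where
  skip           : Program
  _≔_[_,_]       : Loc → Op → Operand → Operand → Program
  _⨾_            : Program → Program → Program
  ifP_then_else_ : Test → Program → Program → Program
  while_loop_    : Test → Program → Program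

record State : Set where
  constructor state
  field
    regs   : ℕ → ℕ
    arrays : ℕ → ℕ → ℕ

open State public

update : ∀ {A : Set} → (ℕ → A) → ℕ → A → ℕ → A
update f i x j = if j ≡ᵇ i then x else f j

fetch : State → Loc → ℕ
fetch σ (reg r)   = regs σ r
fetch σ (arr a r) = arrays σ a (regs σ r)

store : State → Loc → ℕ → State
store σ (reg r)   v = state (update (regs σ) r v) (arrays σ)
store σ (arr a r) v =
  state (regs σ) (update (arrays σ) a (update (arrays σ a) (regs σ r) v))

eval : State → Operand → ℕ
eval σ (lit k) = k
eval σ (at l)  = fetch σ l

apply : Op → ℕ → ℕ → ℕ
apply add x y = x + y
apply sub x y = x ∸ y
apply shl x d = x * 2 ^ d
apply shr x d = _/_ x (2 ^ d) {{m^n≢0 2 d}}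

compare? : Cmp → ℕ → ℕ → Bool
compare? lt x y = x <ᵇ y
compare? le x y = x ≤ᵇ y
compare? eq x y = x ≡ᵇ y

holds : State → Test → Bool
holds σ (test c x y) = compare? c (eval σ x) (eval σ y)

-- Numbers may be arbitrarily long, but are charged by the number of machine
-- words they occupy, so that an operation costs O(1) only on numbers of O(1)
-- words.  There are two word lengths, w and W: additions and comparisons are
-- charged in words of W bits, everything else (in particular addressing) in
-- words of w bits.
module Costs (w W : ℕ) .{{_ : NonZero w}} .{{_ : NonZero W}} where

  words : (b : ℕ) .{{_ : NonZero b}} → ℕ → ℕ
  words b x = suc (⌊log₂ x ⌋ / b)

  opWords : Op → ℕ → ℕ
  opWords add = words W
  opWords sub = words w
  opWords shl = words w
  opWords shr = words w

  locCost : State → Loc → ℕ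
  locCost σ (reg r)   = 1
  locCost σ (arr a r) = words w (regs σ r)

  operandCost : State → Operand → ℕ
  operandCost σ (lit k) = 1
  operandCost σ (at l)  = locCost σ l

  assignCost : State → Loc → Op → Operand → Operand → ℕ
  assignCost σ l o x y =
    locCost σ l + operandCost σ x + operandCost σ y
    + opWords o (eval σ x) + opWords o (eval σ y)
    + opWords o (apply o (eval σ x) (eval σ y))

  -- Numbers with different word counts are compared by these counts alone, so
  -- only the length of the shorter number is charged.  This matters for items
  -- much heavier than the capacity.
  testCost : State → Test → ℕ
  testCost σ (test c x y) =
    operandCost σ x + operandCost σ y + (words W (eval σ x) ⊓ words W (eval σ y))

  -- Exec p σ τ k : started in σ, the program p halts in τ at total cost k.
  data Exec : Program → State → State → ℕ → Set where
    skip : ∀ {σ} → Exec skip σ σ 1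

    assign : ∀ {σ l o x y} →
      Exec (l ≔ o [ x , y ]) σ (store σ l (apply o (eval σ x) (eval σ y)))
           (assignCost σ l o x y)

    seq : ∀ {p q σ τ υ k m} →
      Exec p σ τ k → Exec q τ υ m → Exec (p ⨾ q) σ υ (k + m)

    if-true : ∀ {c p q σ τ k} → holds σ c ≡ true →
      Exec p σ τ k → Exec (ifP c then p else q) σ τ (testCost σ c + k)

    if-false : ∀ {c p q σ τ k} → holds σ c ≡ false →
      Exec q σ τ k → Exec (ifP c then p else q) σ τ (testCost σ c + k)

    while-true : ∀ {c p σ τ υ k m} → holds σ c ≡ true →
      Exec p σ τ k → Exec (while c loop p) τ υ m →
      Exec (while c loop p) σ υ (testCost σ c + k + m)

    while-false : ∀ {c p σ} → holds σ c ≡ false →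
      Exec (while c loop p) σ σ (testCost σ c)

------------------------------------------------------------------------
-- Knapsack counting on the machine

bitLength : ℕ → ℕ
bitLength x = suc ⌊log₂ x ⌋

-- Words hold Θ(log n) bits, except that numbers of O(log C) bits can also be
-- added and compared at unit cost.
module KnapsackCosts (n : ℕ) (C : ℤ) =
  Costs (bitLength n) (bitLength (n ⊔ ℤ.∣ C ∣))

listToArray : List ℕ → ℕ → ℕ
listToArray []       i       = 0
listToArray (x ∷ xs) zero    = x
listToArray (x ∷ xs) (suc i) = listToArray xs i

-- The bit of weight 2⁻ⁱ in the binary expansion of ε ≥ 0.
binaryDigit : ℚ → ℕ → ℕ
binaryDigit ε i = (ℤ.∣ ↥ ε ∣ * 2 ^ i / ↧ₙ ε) % 2

negative? : ℤ → ℕ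
negative? (+ _)    = 0
negative? -[1+ _ ] = 1

-- Registers 0, 1, 2 hold n, the sign of C and |C|; array 0 holds the weights
-- and array 1 the binary expansion of ε, of which the machine pays only for
-- the bits it reads.  All other memory is initially zero.
input : ∀ {n} → Vec ℕ n → ℤ → ℚ → State
input {n} w C ε = state registers contents
  where
  registers : ℕ → ℕ
  registers 0 = n
  registers 1 = negative? C
  registers 2 = ℤ.∣ C ∣
  registers _ = 0

  contents : ℕ → ℕ → ℕ
  contents 0   = listToArray (Vec.toList w)
  contents 1   = binaryDigit ε
  contents _ _ = 0

-- Register 0 holds the exponent bits and register 1 the mantissa bits.
record Outputs {e t} (σ : State) (Z : Float e t) : Set where
  field
    exponent-out : regs σ 0 ≡ unsigned (Float.exponentBits Z)
    mantissa-out : regs σ 1 ≡ unsigned (Float.mantissa Z)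

Computes : ∀ {n e t} → Program → Vec ℕ n → ℤ → ℚ → Float e t → ℕ → Set
Computes {n} P w C ε Z time =
  ∃[ σ ] KnapsackCosts.Exec n C P (input w C ε) σ time × Outputs σ Z

exponentLength : ℕ → ℕ
exponentLength n = ⌈log[ 2 ] fromℕ n ⌉

mantissaLength : ℕ → (ε : ℚ) → .{{ℚ.Positive ε}} → ℕ
mantissaLength n ε = 1 + ⌈log[ 2 ] fromℕ n ℚ.* recip ε ⌉

-- ⌈ log (1/ε) / log n ⌉, with log n read as 1 if n = 1 and the result as 1 if
-- ε = 1, where the formula is undefined or allows no time at all.
logFactor : ℕ → (ε : ℚ) → .{{ℚ.Positive ε}} → ℕ
logFactor n ε = 1 ⊔ ⌈log[ n ⊔ 2 ] recip ε ⌉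

-- n³ ε⁻¹ ⌈ log (1/ε) / log n ⌉
timeBound : ℕ → (ε : ℚ) → .{{ℚ.Positive ε}} → ℚ
timeBound n ε = fromℕ (n ^ 3) ℚ.* recip ε ℚ.* fromℕ (logFactor n ε)

-- Let s(l, c) be the number of solutions of capacity c with the last l items, a
-- step function of c with s(l + 1, c) = s(l, c) + s(l, c − w).  Every value is
-- rounded down to a mantissa of k + 1 bits, where 2ᵏ ≥ n / ε.  One rounding
-- loses at most the fraction 2⁻ᵏ of a value, hence n roundings lose at most the
-- fraction ε.  There are only O(n 2ᵏ) = O(n² / ε) rounded values below 2ⁿ, and a
-- breakpoint at which the rounded value does not increase can be dropped.  So the
-- step function keeps O(n² / ε) steps, and for each of the n items it is merged
-- with its translate by w in O(n² / ε) operations.  All indices and rounded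
-- values are polynomial in n / ε, so that they occupy O(⌈log (1/ε) / log n⌉)
-- words of log n bits; the breakpoints are only added and compared.

{-# OPTIONS --safe #-}
module Submission where

open import Defs
open import Data.Bool.Base using (Bool; true; false; if_then_else_; _∧_; _∨_; T)
open import Data.Empty using (⊥; ⊥-elim)
open import Data.Fin.Subset using (Subset; inside; outside)
open import Data.Integer.Base as ℤ using (ℤ; -[1+_])
import Data.Integer.DivMod as ℤ
import Data.Integer.Properties as ℤ
open import Data.List.Base using (List; []; _∷_; _++_; map; length; filter)
import Data.List.Properties as List
import Data.List.Relation.Unary.All as All
open import Data.Nat.Base
open import Data.Nat.DivMod
open import Data.Nat.Logarithm using (⌊log₂_⌋; ⌊log₂⌋-mono-≤; ⌊log₂[2^n]⌋≡n)
open import Data.Nat.Properties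
open import Data.Nat.Tactic.RingSolver using (solve-∀)
open import Data.Product.Base using (_×_; _,_; proj₁; proj₂; ∃-syntax)
open import Data.Rational.Base as ℚ using (ℚ; ½; 0ℚ; 1ℚ; ↥_; ↧ₙ_; ceiling)
import Data.Rational.Properties as ℚ
open import Data.Rational.Solver renaming (module +-*-Solver to ℚ-Solver)
import Data.Rational.Unnormalised.Base as ℚᵘ
import Data.Rational.Unnormalised.Properties as ℚᵘ
open import Data.Sum.Base using (_⊎_; inj₁; inj₂)
open import Data.Unit.Base using (⊤; tt)
open import Data.Vec.Base as Vec using (Vec; []; _∷_)
open import Function.Base using (_∘_; id)
open import Relation.Binary.PropositionalEquality
open import Relation.Nullary using (¬_; Dec; yes; no; does)
open import Relation.Nullary.Decidable using (dec-true)

-- Codes of floating-point numbers and their rounded addition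

infixl 7 _≫_

_≫_ : ℕ → ℕ → ℕ
x ≫ d = apply shr x d

≫-lower : ∀ x d → (x ≫ d) * 2 ^ d ≤ x
≫-lower x d = m/n*n≤m x (2 ^ d) {{m^n≢0 2 d}}

≫-upper : ∀ x d → x < suc (x ≫ d) * 2 ^ d
≫-upper x d = begin-strict
  x                                 ≡⟨ m≡m%n+[m/n]*n x (2 ^ d) ⟩
  x % 2 ^ d + (x / 2 ^ d) * 2 ^ d   <⟨ +-monoˡ-< _ (m%n<n x (2 ^ d)) ⟩
  2 ^ d + (x / 2 ^ d) * 2 ^ d       ∎
  where
  open ≤-Reasoning
  instance
    2^d≢0 : NonZero (2 ^ d)
    2^d≢0 = m^n≢0 2 d

≫-unique : ∀ {x d q} → q * 2 ^ d ≤ x → x < suc q * 2 ^ d → x ≫ d ≡ q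
≫-unique {x} {d} {q} lo hi = ≤-antisym
  (s≤s⁻¹ (*-cancelʳ-< (2 ^ d) (x ≫ d) (suc q) (≤-<-trans (≫-lower x d) hi)))
  (s≤s⁻¹ (*-cancelʳ-< (2 ^ d) q (suc (x ≫ d)) (≤-<-trans lo (≫-upper x d))))

-- Nonnegative floating-point numbers with a mantissa of k + 1 bits are stored
-- as codes, single naturals that are ordered like the numbers themselves: for
-- M = 2 ^ k, the code E M + s stands for s 2ᴱ, in units of 1 / M, where s < 2 M
-- and, unless E = 0, M ≤ s.
module Codes (k : ℕ) where

  M : ℕ
  M = 2 ^ k

  instance
    M≢0 : NonZero M
    M≢0 = m^n≢0 2 k

  expo mant val : ℕ → ℕ
  expo x = (x ≫ k) ∸ 1
  mant x = x ∸ expo x * M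
  val x  = mant x * 2 ^ expo x

  infixl 6 _⊕_

  pack : ℕ → ℕ → ℕ
  pack E s = (E + (s ≫ (1 + k))) * M + (s ≫ (s ≫ (1 + k)))

  _⊕_ : ℕ → ℕ → ℕ
  u ⊕ v = pack E ((mant u ≫ (E ∸ expo u)) + (mant v ≫ (E ∸ expo v)))
    where
    E : ℕ
    E = expo u + (expo v ∸ expo u)

  record Canonical (E s : ℕ) : Set where
    constructor canonical
    field
      s<2M   : s < 2 * M
      normal : E ≡ 0 ⊎ M ≤ s

  open Canonical

  M<2M : M < 2 * M
  M<2M = subst (M <_) (*-comm M 2) (m<m*n M 2 (s≤s (s≤s z≤n)))

  encode-expo : ∀ {E s} → Canonical E s → expo (E * M + s) ≡ E
  encode-expo {zero} {s} c = n≤0⇒n≡0 (begin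
    (s ≫ k) ∸ 1     ≤⟨ ∸-monoˡ-≤ 1 (s≤s⁻¹ (*-cancelʳ-< M (s ≫ k) 2 (≤-<-trans (≫-lower s k) (s<2M c)))) ⟩
    1 ∸ 1           ≡⟨⟩
    0               ∎)
    where open ≤-Reasoning
  encode-expo {suc E} {s} (canonical s<2M (inj₂ M≤s)) = cong (_∸ 1) (≫-unique {d = k}
    (begin
      (2 + E) * M        ≡⟨ +-comm M (suc E * M) ⟩
      suc E * M + M      ≤⟨ +-monoʳ-≤ (suc E * M) M≤s ⟩
      suc E * M + s      ∎)
    (begin-strict
      suc E * M + s      <⟨ +-monoʳ-< (suc E * M) s<2M ⟩
      suc E * M + 2 * M  ≡⟨ *-distribʳ-+ M (suc E) 2 ⟨
      (suc E + 2) * M    ≡⟨ cong (_* M) (+-comm (suc E) 2) ⟩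
      (3 + E) * M        ∎))
    where open ≤-Reasoning

  encode-val : ∀ {E s} → Canonical E s → val (E * M + s) ≡ s * 2 ^ E
  encode-val {E} {s} c rewrite encode-expo c = cong (_* 2 ^ E) (m+n∸m≡n (E * M) s)

  decode : ∀ x → x ≡ expo x * M + mant x × Canonical (expo x) (mant x)
  decode x with x ≫ k | ≫-lower x k | ≫-upper x k
  ... | zero  | _  | hi = refl , canonical (<-≤-trans hi (*-monoˡ-≤ M {1} {2} (s≤s z≤n))) (inj₁ refl)
  ... | suc q | lo | hi = sym (m+[n∸m]≡n q≤x) , canonical
      (+-cancelˡ-< (q * M) _ _ (begin-strict
        q * M + (x ∸ q * M)  ≡⟨ m+[n∸m]≡n q≤x ⟩
        x                    <⟨ hi ⟩
        (2 + q) * M          ≡⟨ cong (_* M) (+-comm 2 q) ⟩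
        (q + 2) * M          ≡⟨ *-distribʳ-+ M q 2 ⟩
        q * M + 2 * M        ∎))
      (inj₂ (+-cancelˡ-≤ (q * M) _ _ (begin
        q * M + M            ≡⟨ +-comm (q * M) M ⟩
        suc q * M            ≤⟨ lo ⟩
        x                    ≡⟨ m+[n∸m]≡n q≤x ⟨
        q * M + (x ∸ q * M)  ∎)))
    where
    open ≤-Reasoning
    q≤x : q * M ≤ x
    q≤x = ≤-trans (m≤n+m (q * M) M) lo

  val-suc : ∀ x → val x ≤ val (suc x)
  val-suc x with decode x
  ... | x≡ , canonical s<2M n with suc (mant x) <? 2 * M
  ... | yes 1+s<2M = begin
    mant x * 2 ^ expo x                ≤⟨ *-monoˡ-≤ (2 ^ expo x) (n≤1+n (mant x)) ⟩
    suc (mant x) * 2 ^ expo x          ≡⟨ encode-val {expo x} (canonical 1+s<2M (n′ n)) ⟨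
    val (expo x * M + suc (mant x))    ≡⟨ cong val (+-suc _ _) ⟩
    val (suc (expo x * M + mant x))    ≡⟨ cong (val ∘ suc) x≡ ⟨
    val (suc x)                        ∎
    where
    open ≤-Reasoning
    n′ : expo x ≡ 0 ⊎ M ≤ mant x → expo x ≡ 0 ⊎ M ≤ suc (mant x)
    n′ (inj₁ e) = inj₁ e
    n′ (inj₂ l) = inj₂ (≤-trans l (n≤1+n _))
  ... | no 1+s≮2M = begin
    mant x * 2 ^ expo x                ≤⟨ *-monoˡ-≤ (2 ^ expo x) (n≤1+n (mant x)) ⟩
    suc (mant x) * 2 ^ expo x          ≡⟨ cong (_* 2 ^ expo x) 1+s≡2M ⟩
    2 * M * 2 ^ expo x                 ≡⟨ (λ a b → trans (cong (_* b) (*-comm 2 a)) (*-assoc a 2 b)) M (2 ^ expo x) ⟩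
    M * 2 ^ suc (expo x)               ≡⟨ encode-val {suc (expo x)} (canonical M<2M (inj₂ ≤-refl)) ⟨
    val (suc (expo x) * M + M)         ≡⟨ cong val (trans (cong (_+ M) (+-comm M _)) (+-assoc (expo x * M) M M)) ⟩
    val (expo x * M + (M + M))         ≡⟨ cong (λ a → val (expo x * M + a)) (trans (cong (M +_) (sym (+-identityʳ M))) (sym 1+s≡2M)) ⟩
    val (expo x * M + suc (mant x))    ≡⟨ cong val (+-suc _ _) ⟩
    val (suc (expo x * M + mant x))    ≡⟨ cong (val ∘ suc) x≡ ⟨
    val (suc x)                        ∎
    where
    open ≤-Reasoning
    1+s≡2M : suc (mant x) ≡ 2 * M
    1+s≡2M = ≤-antisym s<2M (≮⇒≥ 1+s≮2M)

  val-mono : ∀ {x y} → x ≤ y → val x ≤ val y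
  val-mono = mono′ ∘ ≤⇒≤′
    where
    mono′ : ∀ {x y} → x ≤′ y → val x ≤ val y
    mono′ ≤′-refl     = ≤-refl
    mono′ (≤′-step l) = ≤-trans (mono′ l) (val-suc _)

  code-bound : ∀ m {x} → val x < M * 2 ^ m → x < suc m * M
  code-bound m {x} v< = ≰⇒> λ ge → <⇒≱ v< (begin
    M * 2 ^ m         ≡⟨ encode-val {m} (canonical M<2M (inj₂ ≤-refl)) ⟨
    val (m * M + M)   ≤⟨ val-mono (≤-trans (≤-reflexive (+-comm (m * M) M)) ge) ⟩
    val x             ∎)
    where open ≤-Reasoning

  -- s 2ᴱ is N rounded down to a multiple of 2ᴱ.
  record Aligned (E s N : ℕ) : Set where
    constructor aligned
    field
      s<4M   : s < 4 * M
      below  : s * 2 ^ E ≤ N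
      above  : N < suc s * 2 ^ E
      normal : E ≡ 0 ⊎ M ≤ s

  align : ∀ {e f a b} → f ≤ e → Canonical e a → Canonical f b →
          Aligned e (a + (b ≫ (e ∸ f))) (a * 2 ^ e + b * 2 ^ f)
  align {e} {f} {a} {b} f≤e (canonical a< na) (canonical b< _) = aligned
    (begin-strict
      a + b′            <⟨ +-mono-<-≤ a< (≤-trans b′≤b (<⇒≤ b<)) ⟩
      2 * M + 2 * M     ≡⟨ *-distribʳ-+ M 2 2 ⟨
      4 * M             ∎)
    (begin
      (a + b′) * 2 ^ e           ≡⟨ *-distribʳ-+ (2 ^ e) a b′ ⟩
      a * 2 ^ e + b′ * 2 ^ e     ≤⟨ +-monoʳ-≤ (a * 2 ^ e) (begin
        b′ * 2 ^ e               ≡⟨ split b′ ⟩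
        b′ * 2 ^ d * 2 ^ f       ≤⟨ *-monoˡ-≤ (2 ^ f) (≫-lower b d) ⟩
        b * 2 ^ f                ∎) ⟩
      a * 2 ^ e + b * 2 ^ f      ∎)
    (begin-strict
      a * 2 ^ e + b * 2 ^ f           <⟨ +-monoʳ-< (a * 2 ^ e) (begin-strict
        b * 2 ^ f                     <⟨ *-monoˡ-< (2 ^ f) {{m^n≢0 2 f}} (≫-upper b d) ⟩
        suc b′ * 2 ^ d * 2 ^ f        ≡⟨ split (suc b′) ⟨
        suc b′ * 2 ^ e                ∎) ⟩
      a * 2 ^ e + suc b′ * 2 ^ e      ≡⟨ *-distribʳ-+ (2 ^ e) a (suc b′) ⟨
      (a + suc b′) * 2 ^ e            ≡⟨ cong (_* 2 ^ e) (+-suc a b′) ⟩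
      suc (a + b′) * 2 ^ e            ∎)
    (norm na)
    where
    open ≤-Reasoning
    d b′ : ℕ
    d  = e ∸ f
    b′ = b ≫ d
    b′≤b : b′ ≤ b
    b′≤b = m/n≤m b (2 ^ d) {{m^n≢0 2 d}}
    split : ∀ x → x * 2 ^ e ≡ x * 2 ^ d * 2 ^ f
    split x = trans (cong (λ e → x * 2 ^ e) (sym (m∸n+n≡m f≤e)))
                (trans (cong (x *_) (^-distribˡ-+-* 2 d f)) (sym (*-assoc x (2 ^ d) (2 ^ f))))
    norm : e ≡ 0 ⊎ M ≤ a → e ≡ 0 ⊎ M ≤ a + b′
    norm (inj₁ e≡0) = inj₁ e≡0
    norm (inj₂ M≤a) = inj₂ (≤-trans M≤a (m≤m+n a b′))

  record Rounds (r N : ℕ) : Set where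
    constructor rounds
    field
      below : val r ≤ N
      above : M * N ≤ M * val r + N
      exact : N < 2 * M → N ≤ val r

  rounds-pack : ∀ {E s N} → Aligned E s N → Rounds (pack E s) N
  rounds-pack {E} {s} {N} (aligned s<4M lo hi nrm) with s <? 2 * M
  ... | yes s<2M = subst (λ r → Rounds r N) (sym pack≡) (rounds
      (≤-trans (≤-reflexive val≡) lo) (above nrm) (exact nrm))
    where
    open ≤-Reasoning
    q≡0 : s ≫ (1 + k) ≡ 0
    q≡0 = ≫-unique {s} {1 + k} z≤n (≤-trans s<2M (≤-reflexive (sym (+-identityʳ _))))
    pack≡ : pack E s ≡ E * M + s
    pack≡ rewrite q≡0 = cong₂ _+_ (cong (_* M) (+-identityʳ E)) (n/1≡n s)
    val≡ : val (E * M + s) ≡ s * 2 ^ E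
    val≡ = encode-val {E} (canonical s<2M nrm)
    N≤s : E ≡ 0 → N ≤ s * 2 ^ E
    N≤s refl = ≤-trans (s≤s⁻¹ hi) (≤-reflexive refl)
    above : E ≡ 0 ⊎ M ≤ s → M * N ≤ M * val (E * M + s) + N
    above (inj₁ E≡0) = ≤-trans (*-monoʳ-≤ M (≤-trans (N≤s E≡0) (≤-reflexive (sym val≡)))) (m≤m+n _ N)
    above (inj₂ M≤s) = begin
      M * N                             ≤⟨ *-monoʳ-≤ M (<⇒≤ hi) ⟩
      M * (2 ^ E + s * 2 ^ E)           ≡⟨ *-distribˡ-+ M (2 ^ E) (s * 2 ^ E) ⟩
      M * 2 ^ E + M * (s * 2 ^ E)       ≡⟨ +-comm (M * 2 ^ E) _ ⟩
      M * (s * 2 ^ E) + M * 2 ^ E       ≤⟨ +-monoʳ-≤ (M * (s * 2 ^ E)) (≤-trans (*-monoˡ-≤ (2 ^ E) M≤s) lo) ⟩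
      M * (s * 2 ^ E) + N               ≡⟨ cong (λ v → M * v + N) val≡ ⟨
      M * val (E * M + s) + N           ∎
    exact : E ≡ 0 ⊎ M ≤ s → N < 2 * M → N ≤ val (E * M + s)
    exact (inj₁ E≡0) _ = ≤-trans (N≤s E≡0) (≤-reflexive (sym val≡))
    exact (inj₂ M≤s) N<2M = by-E E refl
      where
      by-E : ∀ E′ → E ≡ E′ → N ≤ val (E * M + s)
      by-E zero     E≡0  = exact (inj₁ E≡0) N<2M
      by-E (suc E′) refl = ⊥-elim (<⇒≱ N<2M (begin
        2 * M                ≡⟨ *-comm 2 M ⟩
        M * 2                ≤⟨ *-mono-≤ M≤s (m≤m*n 2 (2 ^ E′) {{m^n≢0 2 E′}}) ⟩
        s * 2 ^ suc E′       ≤⟨ lo ⟩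
        N                    ∎))
  ... | no s≮2M = subst (λ r → Rounds r N) (sym pack≡) (rounds
      (begin
        val (suc E * M + h)   ≡⟨ val≡ ⟩
        h * 2 ^ suc E         ≡⟨ *-assoc h 2 (2 ^ E) ⟨
        h * 2 * 2 ^ E         ≤⟨ *-monoˡ-≤ (2 ^ E) (≫-lower s 1) ⟩
        s * 2 ^ E             ≤⟨ lo ⟩
        N                     ∎)
      (begin
        M * N                                     ≤⟨ *-monoʳ-≤ M (<⇒≤ hi) ⟩
        M * (suc s * 2 ^ E)                       ≤⟨ *-monoʳ-≤ M (*-monoˡ-≤ (2 ^ E) (≫-upper s 1)) ⟩
        M * ((2 + h * 2) * 2 ^ E)                 ≡⟨ regroup M h (2 ^ E) ⟩
        M * (h * (2 * 2 ^ E)) + 2 * M * 2 ^ E     ≤⟨ +-monoʳ-≤ (M * (h * (2 * 2 ^ E))) (≤-trans (*-monoˡ-≤ (2 ^ E) 2M≤s) lo) ⟩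
        M * (h * (2 * 2 ^ E)) + N                 ≡⟨ cong (λ v → M * v + N) val≡ ⟨
        M * val (suc E * M + h) + N               ∎)
      (λ N<2M → ⊥-elim (<⇒≱ N<2M (≤-trans 2M≤s (≤-trans (m≤m*n s (2 ^ E) {{m^n≢0 2 E}}) lo)))))
    where
    open ≤-Reasoning
    regroup : ∀ m h e → m * ((2 + h * 2) * e) ≡ m * (h * (2 * e)) + 2 * m * e
    regroup = solve-∀
    2M≤s : 2 * M ≤ s
    2M≤s = ≮⇒≥ s≮2M
    h : ℕ
    h = s ≫ 1
    q≡1 : s ≫ (1 + k) ≡ 1
    q≡1 = ≫-unique {s} {1 + k} (≤-trans (≤-reflexive (*-identityˡ _)) 2M≤s)
      (≤-trans s<4M (≤-reflexive (*-assoc 2 2 M)))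
    pack≡ : pack E s ≡ suc E * M + h
    pack≡ rewrite q≡1 = cong (λ E → E * M + h) (+-comm E 1)
    val≡ : val (suc E * M + h) ≡ h * 2 ^ suc E
    val≡ = encode-val {suc E} (canonical
      (*-cancelʳ-< 2 h (2 * M) (≤-<-trans (≫-lower s 1) (≤-trans s<4M (≤-reflexive (trans (*-assoc 2 2 M) (*-comm 2 (2 * M)))))))
      (inj₂ (s≤s⁻¹ (*-cancelʳ-< 2 M (suc h) (≤-<-trans (≤-trans (≤-reflexive (*-comm M 2)) 2M≤s) (≫-upper s 1))))))

  ⊕-rounds : ∀ u v → Rounds (u ⊕ v) (val u + val v)
  ⊕-rounds u v with ≤-total (expo v) (expo u)
  ... | inj₁ v≤u rewrite m≤n⇒m∸n≡0 v≤u | +-identityʳ (expo u) | n∸n≡0 (expo u) | n/1≡n (mant u) =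
    rounds-pack (align v≤u (proj₂ (decode u)) (proj₂ (decode v)))
  ... | inj₂ u≤v rewrite m+[n∸m]≡n u≤v | n∸n≡0 (expo v) | n/1≡n (mant v)
                       | +-comm (mant u ≫ (expo v ∸ expo u)) (mant v) | +-comm (val u) (val v) =
    rounds-pack (align u≤v (proj₂ (decode v)) (proj₂ (decode u)))

  -- z approximates, in units of 1 / M, the number s of solutions with m items.
  -- The upper bound is linear in s with slope M − 1 rather than M so that z
  -- does not need the exponent m even if s = 2ᵐ.  This makes the start inexact,
  -- but then the first addition is exact, so m items still cost 1 ⊔ m roundings.
  record Good (m z s : ℕ) : Set where
    constructor good
    field
      s≤2^m : s ≤ 2 ^ m
      upper : val z ≤ pred M * s
      lower : M * s ≤ val z + (1 ⊔ m) * s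

  open Good public

  good-code : ∀ {m z s} → Good m z s → z < suc m * M
  good-code {m} {z} {s} g = code-bound m (begin-strict
    val z             ≤⟨ upper g ⟩
    pred M * s        ≤⟨ *-monoʳ-≤ (pred M) (s≤2^m g) ⟩
    pred M * 2 ^ m    <⟨ *-monoˡ-< (2 ^ m) {{m^n≢0 2 m}} (≤-reflexive (suc-pred M)) ⟩
    M * 2 ^ m         ∎)
    where open ≤-Reasoning

  val-small : ∀ {x} → x < M → val x ≡ x
  val-small x<M = trans (encode-val {0} (canonical (<-trans x<M M<2M) (inj₁ refl))) (*-identityʳ _)

  good-none : ∀ m → Good m 0 0
  good-none m = good z≤n (≤-trans (≤-reflexive (val-small (m^n>0 2 k))) z≤n) (≤-trans (≤-reflexive (*-zeroʳ M)) z≤n)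

  good-start : Good 0 (pred M) 1
  good-start = good ≤-refl
    (≤-reflexive (trans val≡ (sym (*-identityʳ _))))
    (≤-reflexive (trans (*-identityʳ M) (trans (sym (suc-pred M)) (trans (+-comm 1 (pred M)) (cong (_+ 1) (sym val≡))))))
    where
    val≡ : val (pred M) ≡ pred M
    val≡ = val-small (≤-reflexive (suc-pred M))

  good-suc : ∀ {m z s} → Good m z s → Good (suc m) z s
  good-suc {m} {z} {s} g = good
    (≤-trans (s≤2^m g) (^-monoʳ-≤ 2 (n≤1+n m)))
    (upper g)
    (≤-trans (lower g) (+-monoʳ-≤ (val z) (*-monoˡ-≤ s (⊔-monoʳ-≤ 1 (n≤1+n m)))))

  good-between : ∀ {m y z s t} → Good m y s → s ≤ t → z ≤ y → Good m z t → Good m y t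
  good-between {m} {y} {z} {s} {t} gy s≤t z≤y gz = good
    (s≤2^m gz)
    (≤-trans (upper gy) (*-monoʳ-≤ (pred M) s≤t))
    (≤-trans (lower gz) (+-monoˡ-≤ _ (val-mono z≤y)))

  good-⊕ : ∀ {m u v s t} → Good m u s → Good m v t → Good (suc m) (u ⊕ v) (s + t)
  good-⊕ {m} {u} {v} {s} {t} gu gv = good
    (≤-trans (+-mono-≤ (s≤2^m gu) (s≤2^m gv)) (≤-reflexive (cong (2 ^ m +_) (sym (+-identityʳ (2 ^ m))))))
    (≤-trans (Rounds.below ru) N≤)
    (low m refl)
    where
    open ≤-Reasoning
    ru : Rounds (u ⊕ v) (val u + val v)
    ru = ⊕-rounds u v
    N≤ : val u + val v ≤ pred M * (s + t)
    N≤ = ≤-trans (+-mono-≤ (upper gu) (upper gv)) (≤-reflexive (sym (*-distribˡ-+ (pred M) s t)))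
    N≥ : M * (s + t) ≤ val u + val v + (1 ⊔ m) * (s + t)
    N≥ = begin
      M * (s + t)                                               ≡⟨ *-distribˡ-+ M s t ⟩
      M * s + M * t                                             ≤⟨ +-mono-≤ (lower gu) (lower gv) ⟩
      (val u + (1 ⊔ m) * s) + (val v + (1 ⊔ m) * t)             ≡⟨ regroup (val u) (val v) (1 ⊔ m) s t ⟩
      val u + val v + (1 ⊔ m) * (s + t)                         ∎
      where
      regroup : ∀ a b c s t → (a + c * s) + (b + c * t) ≡ a + b + c * (s + t)
      regroup = solve-∀
    low : ∀ m′ → m ≡ m′ → M * (s + t) ≤ val (u ⊕ v) + suc m * (s + t)
    low zero refl = ≤-trans N≥ (+-monoˡ-≤ _ (Rounds.exact ru (begin-strict
      val u + val v       ≤⟨ N≤ ⟩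
      pred M * (s + t)    ≤⟨ *-monoʳ-≤ (pred M) (+-mono-≤ (s≤2^m gu) (s≤2^m gv)) ⟩
      pred M * 2          <⟨ *-monoˡ-< 2 (≤-reflexive (suc-pred M)) ⟩
      M * 2               ≡⟨ *-comm M 2 ⟩
      2 * M               ∎)))
    low (suc m′) refl = begin
      M * (s + t)                                        ≤⟨ N≥ ⟩
      val u + val v + suc m′ * (s + t)                   ≤⟨ +-monoˡ-≤ (suc m′ * (s + t)) N≤r ⟩
      val (u ⊕ v) + (s + t) + suc m′ * (s + t)           ≡⟨ +-assoc (val (u ⊕ v)) (s + t) _ ⟩
      val (u ⊕ v) + suc m * (s + t)                      ∎
      where
      N≤r : val u + val v ≤ val (u ⊕ v) + (s + t)
      N≤r = *-cancelˡ-≤ M (begin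
        M * (val u + val v)                     ≤⟨ Rounds.above ru ⟩
        M * val (u ⊕ v) + (val u + val v)       ≤⟨ +-monoʳ-≤ (M * val (u ⊕ v)) (≤-trans N≤ (*-monoˡ-≤ (s + t) (pred[n]≤n {M}))) ⟩
        M * val (u ⊕ v) + M * (s + t)           ≡⟨ *-distribˡ-+ M (val (u ⊕ v)) (s + t) ⟨
        M * (val (u ⊕ v) + (s + t))             ∎)

-- The recursion over the items

shifted : ℕ → (ℕ → ℕ) → ℕ → ℕ
shifted w s c = if w ≤ᵇ c then s (c ∸ w) else 0

shifted-≤ : ∀ {w} s {c} → w ≤ c → shifted w s c ≡ s (c ∸ w)
shifted-≤ {w} s {c} w≤c with w ≤ᵇ c | ≤⇒≤ᵇ w≤c
... | true | _ = refl

shifted-> : ∀ {w} s {c} → c < w → shifted w s c ≡ 0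
shifted-> {w} s {c} c<w with w ≤ᵇ c | ≤ᵇ⇒≤ w c
... | false | _ = refl
... | true  | h = ⊥-elim (<⇒≱ c<w (h tt))

-- The number of subsets of the items i, …, i + l − 1 of total weight at most c.
count : (ℕ → ℕ) → ℕ → ℕ → ℕ → ℕ
count w i zero    c = 1
count w i (suc l) c = count w (suc i) l c + shifted (w i) (count w (suc i) l) c

shifted-mono : ∀ w {s} → (∀ {b c} → b ≤ c → s b ≤ s c) → ∀ {b c} → b ≤ c → shifted w s b ≤ shifted w s c
shifted-mono w {s} mono {b} {c} b≤c with w ≤? b
... | yes w≤b = subst₂ _≤_ (sym (shifted-≤ s w≤b)) (sym (shifted-≤ s (≤-trans w≤b b≤c))) (mono (∸-monoˡ-≤ w b≤c))
... | no  w≰b = subst (_≤ shifted w s c) (sym (shifted-> s (≰⇒> w≰b))) z≤n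

count-mono : ∀ w i l {b c} → b ≤ c → count w i l b ≤ count w i l c
count-mono w i zero    b≤c = ≤-refl
count-mono w i (suc l) b≤c =
  +-mono-≤ (count-mono w (suc i) l b≤c) (shifted-mono (w i) (count-mono w (suc i) l) b≤c)

count-heavy : ∀ w i l {c} → c < w i → count w i (suc l) c ≡ count w (suc i) l c
count-heavy w i l c<w = trans (cong (count w (suc i) l _ +_) (shifted-> (count w (suc i) l) c<w)) (+-identityʳ _)

shifted-cong : ∀ w {s t} → (∀ c → s c ≡ t c) → ∀ c → shifted w s c ≡ shifted w t c
shifted-cong w s≡t c with w ≤ᵇ c
... | true  = s≡t (c ∸ w)
... | false = refl

count-∷ : ∀ x ws i l c → count (listToArray (x ∷ ws)) (suc i) l c ≡ count (listToArray ws) i l c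
count-∷ x ws i zero    c = refl
count-∷ x ws i (suc l) c = cong₂ _+_ (count-∷ x ws (suc i) l c)
  (shifted-cong (listToArray ws i) (count-∷ x ws (suc i) l) c)

length-filter-map : ∀ {A B : Set} {P : B → Set} {Q : A → Set} (P? : ∀ b → Dec (P b)) (Q? : ∀ a → Dec (Q a)) (f : A → B) →
  (∀ a → P (f a) → Q a) → (∀ a → Q a → P (f a)) → ∀ xs →
  length (filter P? (map f xs)) ≡ length (filter Q? xs)
length-filter-map P? Q? f to from []       = refl
length-filter-map P? Q? f to from (x ∷ xs) with P? (f x) | Q? x
... | yes p | yes q = cong suc (length-filter-map P? Q? f to from xs)
... | yes p | no ¬q = ⊥-elim (¬q (to x p))
... | no ¬p | yes q = ⊥-elim (¬p (from x q))
... | no ¬p | no ¬q = length-filter-map P? Q? f to from xs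

length-filter-none : ∀ {A : Set} {P : A → Set} (P? : ∀ a → Dec (P a)) →
  (∀ a → ¬ P a) → ∀ xs → length (filter P? xs) ≡ 0
length-filter-none P? none xs = cong length (List.filter-none P? (All.universal none xs))

#solutions≡count : ∀ {n} (w : Vec ℕ n) c → #solutions w (ℤ.+ c) ≡ count (listToArray (Vec.toList w)) 0 n c
#solutions≡count []      c = refl
#solutions≡count {suc n} (x ∷ w) c = begin
  length (filter P? (map (outside ∷_) (subsets n) ++ map (inside ∷_) (subsets n)))
    ≡⟨ cong length (List.filter-++ P? (map (outside ∷_) (subsets n)) _) ⟩
  length (filter P? (map (outside ∷_) (subsets n)) ++ filter P? (map (inside ∷_) (subsets n)))
    ≡⟨ List.length-++ (filter P? (map (outside ∷_) (subsets n))) ⟩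
  length (filter P? (map (outside ∷_) (subsets n))) + length (filter P? (map (inside ∷_) (subsets n)))
    ≡⟨ cong₂ _+_ (trans (length-filter-map P? (Q? c) (outside ∷_) (λ _ p → p) (λ _ p → p) (subsets n)) (tail c)) taken ⟩
  count a 1 n c + shifted x (count a 1 n) c ∎
  where
  open ≡-Reasoning
  a : ℕ → ℕ
  a = listToArray (x ∷ Vec.toList w)
  P? : (S : Subset (suc n)) → Dec (ℤ.+ weight (x ∷ w) S ℤ.≤ ℤ.+ c)
  P? S = ℤ.+ weight (x ∷ w) S ℤ.≤? ℤ.+ c
  Q? : ∀ c (S : Subset n) → Dec (ℤ.+ weight w S ℤ.≤ ℤ.+ c)
  Q? c S = ℤ.+ weight w S ℤ.≤? ℤ.+ c
  tail : ∀ c → #solutions w (ℤ.+ c) ≡ count a 1 n c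
  tail c = trans (#solutions≡count w c) (sym (count-∷ x (Vec.toList w) 0 n c))
  taken : length (filter P? (map (inside ∷_) (subsets n))) ≡ shifted x (count a 1 n) c
  taken with x ≤? c
  ... | yes x≤c = trans
    (length-filter-map P? (Q? (c ∸ x)) (inside ∷_)
      (λ S p → ℤ.+≤+ (subst (_≤ c ∸ x) (m+n∸m≡n x (weight w S)) (∸-monoˡ-≤ x (ℤ.drop‿+≤+ p))))
      (λ S q → ℤ.+≤+ (≤-trans (+-monoʳ-≤ x (ℤ.drop‿+≤+ q)) (≤-reflexive (m+[n∸m]≡n x≤c)))) (subsets n))
    (trans (tail (c ∸ x)) (sym (shifted-≤ (count a 1 n) x≤c)))
  ... | no  x≰c = trans
    (trans (length-filter-map {Q = λ _ → ⊥} P? (λ _ → no id) (inside ∷_)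
             (λ S p → x≰c (≤-trans (m≤m+n x (weight w S)) (ℤ.drop‿+≤+ p))) (λ S ()) (subsets n))
           (length-filter-none (λ _ → no id) (λ _ ()) (subsets n)))
    (sym (shifted-> (count a 1 n) (≰⇒> x≰c)))

#solutions-negative : ∀ {n} (w : Vec ℕ n) c → #solutions w -[1+ c ] ≡ 0
#solutions-negative {n} w c = length-filter-none (λ S → ℤ.+ weight w S ℤ.≤? -[1+ c ]) (λ _ ()) (subsets n)

-- Execution and costs

run : Program → State → State
run skip                   σ = σ
run (l ≔ o [ x , y ])      σ = store σ l (apply o (eval σ x) (eval σ y))
run (p ⨾ q)                σ = run q (run p σ)
run (ifP c then p else q)  σ = if holds σ c then run p σ else run q σ
run (while c loop p)       σ = σ

-- A record, so that comparing types does not evaluate p.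
record Yields (p : Program) (σ : State) (Post : State → Set) : Set where
  constructor yields
  field
    post : Post (run p σ)

yields-⨾ : ∀ {p q σ} {Mid Post : State → Set} → Yields p σ Mid → (∀ {τ} → Mid τ → Yields q τ Post) → Yields (p ⨾ q) σ Post
yields-⨾ (yields mid) f = yields (Yields.post (f mid))

-- A static analysis of the cost of programs without loops.  A class bounds the
-- numbers that belong to it by powers, with exponent level, of two quantities Q
-- and R: narrow numbers take O(1) words when charged in words of w bits, big
-- numbers when charged in words of W bits, and x is a shift if 2 ^ x is narrow.
record Class : Set where
  constructor class
  field
    narrow? big? shift? : Bool
    level               : ℕ

open Class

pattern unbounded = class false false false 0
pattern narrow a  = class true false false a
pattern big b     = class false true false b
pattern shift a   = class true false true a

wide? : Class → Bool
wide? c = narrow? c ∨ big? c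

applyClass : Op → Class → Class → Class
applyClass add c d = class (narrow? c ∧ narrow? d) (big? c ∧ big? d) false (suc (level c ⊔ level d))
applyClass sub c d = c
applyClass shl c d = class (narrow? c ∧ shift? d) false false (level c + level d)
applyClass shr c d = c

join : Class → Class → Class
join c d = class (narrow? c ∧ narrow? d) (big? c ∧ big? d) (shift? c ∧ shift? d) (level c ⊔ level d)

record Env : Set where
  constructor env
  field
    regClass arrClass : ℕ → Class

open Env

operandClass : Env → Operand → Class
operandClass Γ (lit k)        = class true true false k
operandClass Γ (at (reg r))   = regClass Γ r
operandClass Γ (at (arr a r)) = arrClass Γ a

storeClass : Env → Loc → Class → Env
storeClass Γ (reg r)   c = env (update (regClass Γ) r c) (arrClass Γ)
storeClass Γ (arr a r) c = env (regClass Γ) (update (arrClass Γ) a (join (arrClass Γ a) c))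

joinEnv : Env → Env → Env
joinEnv Γ Δ = env (λ r → join (regClass Γ r) (regClass Δ r)) (λ a → join (arrClass Γ a) (arrClass Δ a))

after : Program → Env → Env
after skip                  Γ = Γ
after (l ≔ o [ x , y ])     Γ = storeClass Γ l (applyClass o (operandClass Γ x) (operandClass Γ y))
after (p ⨾ q)               Γ = after q (after p Γ)
after (ifP c then p else q) Γ = joinEnv (after p Γ) (after q Γ)
after (while c loop p)      Γ = Γ

locOK : Env → Loc → Bool
locOK Γ (reg r)   = true
locOK Γ (arr a r) = narrow? (regClass Γ r)

operandOK : Env → Operand → Bool
operandOK Γ (lit k) = true
operandOK Γ (at l)  = locOK Γ l

opOK : Op → Class → Bool
opOK add = wide?
opOK sub = narrow?
opOK shl = narrow?
opOK shr = narrow?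

testOK : Env → Test → Bool
testOK Γ (test c x y) = operandOK Γ x ∧ operandOK Γ y ∧ (wide? (operandClass Γ x) ∨ wide? (operandClass Γ y))

programOK : Program → Env → Bool
programOK skip                  Γ = true
programOK (l ≔ o [ x , y ])     Γ =
  locOK Γ l ∧ operandOK Γ x ∧ operandOK Γ y ∧ opOK o (operandClass Γ x) ∧ opOK o (operandClass Γ y) ∧
  opOK o (applyClass o (operandClass Γ x) (operandClass Γ y))
programOK (p ⨾ q)               Γ = programOK p Γ ∧ programOK q (after p Γ)
programOK (ifP c then p else q) Γ = testOK Γ c ∧ programOK p Γ ∧ programOK q Γ
programOK (while c loop p)      Γ = false

locBound : Env → Loc → ℕ
locBound Γ (reg r)   = 1
locBound Γ (arr a r) = suc (level (regClass Γ r))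

operandBound : Env → Operand → ℕ
operandBound Γ (lit k) = 1
operandBound Γ (at l)  = locBound Γ l

wordBound : Class → ℕ
wordBound c = suc (level c)

testBound : Env → Test → ℕ
testBound Γ (test c x y) = operandBound Γ x + operandBound Γ y +
  (if wide? (operandClass Γ x) then wordBound (operandClass Γ x) else wordBound (operandClass Γ y))

costBound : Program → Env → ℕ
costBound skip                  Γ = 1
costBound (l ≔ o [ x , y ])     Γ =
  locBound Γ l + operandBound Γ x + operandBound Γ y
  + wordBound (operandClass Γ x) + wordBound (operandClass Γ y)
  + wordBound (applyClass o (operandClass Γ x) (operandClass Γ y))
costBound (p ⨾ q)               Γ = costBound p Γ + costBound q (after p Γ)
costBound (ifP c then p else q) Γ = testBound Γ c + (costBound p Γ + costBound q Γ)
costBound (while c loop p)      Γ = 0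

classes : List Class → ℕ → Class
classes []       i       = unbounded
classes (c ∷ cs) zero    = c
classes (c ∷ cs) (suc i) = classes cs i

T-∧⁻ : ∀ {a b} → T (a ∧ b) → T a × T b
T-∧⁻ {true} t = tt , t

split-if : ∀ b {A : Set} (P : A → Set) {x y : A} → P x → P y → P (if b then x else y)
split-if true  P px py = px
split-if false P px py = py

update-all : ∀ {A : Set} (P : ℕ → A → Set) {f : ℕ → A} {i x} →
  (∀ j → P j (f j)) → (∀ j → P j x) → ∀ j → P j (update f i x j)
update-all P {i = i} pf px j = split-if (j ≡ᵇ i) (P j) (px j) (pf j)

n<2^n : ∀ n → n < 2 ^ n
n<2^n zero    = ≤-refl
n<2^n (suc n) = +-mono-≤ (m^n>0 2 n) (≤-trans (n<2^n n) (≤-reflexive (sym (+-identityʳ _))))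

module Machine (w W ℓ : ℕ) .{{_ : NonZero w}} .{{_ : NonZero W}} (w≤W : w ≤ W) (1≤ℓ : 1 ≤ ℓ) where

  open Costs w W

  Q R : ℕ
  Q = 2 ^ (w * ℓ)
  R = 2 ^ W

  instance
    Q≢0 : NonZero Q
    Q≢0 = m^n≢0 2 (w * ℓ)
    R≢0 : NonZero R
    R≢0 = m^n≢0 2 W

  2≤Q : 2 ≤ Q
  2≤Q = ^-monoʳ-≤ 2 {1} {w * ℓ} (*-mono-≤ (>-nonZero⁻¹ w) 1≤ℓ)

  2≤R : 2 ≤ R
  2≤R = ^-monoʳ-≤ 2 {1} {W} (>-nonZero⁻¹ W)

  infix 4 _≲_

  record _≲_ (x a : ℕ) : Set where
    constructor scaled
    field
      ≤-scaled : x ≤ a * ℓ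

  module _ where
    open ≤-Reasoning

    words-pow : ∀ b .{{_ : NonZero b}} a {x} → x ≤ 2 ^ (b * a) → words b x ≤ suc a
    words-pow b a {x} x≤ = s≤s (begin
      ⌊log₂ x ⌋ / b               ≤⟨ /-monoˡ-≤ b (⌊log₂⌋-mono-≤ x≤) ⟩
      ⌊log₂ 2 ^ (b * a) ⌋ / b     ≡⟨ cong (_/ b) (trans (⌊log₂[2^n]⌋≡n (b * a)) (*-comm b a)) ⟩
      a * b / b                   ≡⟨ m*n/n≡m a b ⟩
      a                           ∎)

    words-narrow : ∀ a {x} → x ≤ Q ^ a → words w x ≲ suc a
    words-narrow a {x} x≤ = scaled (begin
      words w x      ≤⟨ words-pow w (a * ℓ) (≤-trans x≤ (≤-reflexive (trans (^-*-assoc 2 (w * ℓ) a)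
                          (cong (2 ^_) (trans (*-assoc w ℓ a) (cong (w *_) (*-comm ℓ a))))))) ⟩
      suc (a * ℓ)    ≤⟨ +-monoˡ-≤ (a * ℓ) 1≤ℓ ⟩
      suc a * ℓ      ∎)

    words-big : ∀ b {x} → x ≤ R ^ b → words W x ≲ suc b
    words-big b {x} x≤ = scaled (begin
      words W x      ≤⟨ words-pow W b (≤-trans x≤ (≤-reflexive (^-*-assoc 2 W b))) ⟩
      suc b          ≡⟨ *-identityʳ (suc b) ⟨
      suc b * 1      ≤⟨ *-monoʳ-≤ (suc b) 1≤ℓ ⟩
      suc b * ℓ      ∎)

    words-mono : ∀ x → words W x ≤ words w x
    words-mono x = s≤s (/-monoʳ-≤ ⌊log₂ x ⌋ w≤W)

    1≲1 : 1 ≲ 1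
    1≲1 = scaled (*-mono-≤ {1} ≤-refl 1≤ℓ)

    ≲-trans : ∀ {x y a} → x ≤ y → y ≲ a → x ≲ a
    ≲-trans x≤y (scaled y≤) = scaled (≤-trans x≤y y≤)

    ≲-weaken : ∀ {x a b} → a ≤ b → x ≲ a → x ≲ b
    ≲-weaken a≤b (scaled x≤) = scaled (≤-trans x≤ (*-monoˡ-≤ ℓ a≤b))

    infixl 6 _+≲_

    _+≲_ : ∀ {a b x y} → x ≲ a → y ≲ b → x + y ≲ a + b
    _+≲_ {a} {b} (scaled x≤) (scaled y≤) = scaled (≤-trans (+-mono-≤ x≤ y≤) (≤-reflexive (sym (*-distribʳ-+ ℓ a b))))

    base-+ : ∀ {B a b x y} → 2 ≤ B → x ≤ B ^ a → y ≤ B ^ b → x + y ≤ B ^ suc (a ⊔ b)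
    base-+ {B@(suc _)} {a} {b} {x} {y} 2≤B x≤ y≤ = begin
      x + y                          ≤⟨ +-mono-≤ (≤-trans x≤ (^-monoʳ-≤ B (m≤m⊔n a b))) (≤-trans y≤ (^-monoʳ-≤ B (m≤n⊔m a b))) ⟩
      B ^ (a ⊔ b) + B ^ (a ⊔ b)      ≡⟨ cong (B ^ (a ⊔ b) +_) (+-identityʳ _) ⟨
      2 * B ^ (a ⊔ b)                ≤⟨ *-monoˡ-≤ (B ^ (a ⊔ b)) 2≤B ⟩
      B ^ suc (a ⊔ b)                ∎

    lit-bound : ∀ {B} k → 2 ≤ B → k ≤ B ^ k
    lit-bound {B} k 2≤B = ≤-trans (<⇒≤ (n<2^n k)) (^-monoˡ-≤ k 2≤B)

  infix 4 _∋_ _⊨_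

  record _∋_ (c : Class) (x : ℕ) : Set where
    constructor member
    field
      as-narrow : T (narrow? c) → x ≤ Q ^ level c
      as-big    : T (big? c)    → x ≤ R ^ level c
      as-shift  : T (shift? c)  → 2 ^ x ≤ Q ^ level c

  open _∋_

  ∋-unbounded : ∀ {x} → unbounded ∋ x
  ∋-unbounded = member (λ ()) (λ ()) (λ ())

  ∋-narrow : ∀ {a x} → x ≤ Q ^ a → narrow a ∋ x
  ∋-narrow x≤ = member (λ _ → x≤) (λ ()) (λ ())

  ∋-big : ∀ {b x} → x ≤ R ^ b → big b ∋ x
  ∋-big x≤ = member (λ ()) (λ _ → x≤) (λ ())

  ∋-shift : ∀ {a x} → 2 ^ x ≤ Q ^ a → shift a ∋ x
  ∋-shift {x = x} x≤ = member (λ _ → ≤-trans (lit-bound x ≤-refl) x≤) (λ ()) (λ _ → x≤)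

  ∋-apply : ∀ o {c d x y} → c ∋ x → d ∋ y → applyClass o c d ∋ apply o x y
  ∋-apply add {c} {d} p q = member
    (λ t → base-+ {a = level c} 2≤Q (as-narrow p (proj₁ (T-∧⁻ t))) (as-narrow q (proj₂ (T-∧⁻ {narrow? c} t))))
    (λ t → base-+ {a = level c} 2≤R (as-big p (proj₁ (T-∧⁻ t))) (as-big q (proj₂ (T-∧⁻ {big? c} t))))
    (λ ())
  ∋-apply sub {x = x} {y} p q = member
    (λ t → ≤-trans (m∸n≤m x y) (as-narrow p t))
    (λ t → ≤-trans (m∸n≤m x y) (as-big p t))
    (λ t → ≤-trans (^-monoʳ-≤ 2 (m∸n≤m x y)) (as-shift p t))
  ∋-apply shl {c} {d} p q = member
    (λ t → ≤-trans (*-mono-≤ (as-narrow p (proj₁ (T-∧⁻ t))) (as-shift q (proj₂ (T-∧⁻ {narrow? c} t))))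
                   (≤-reflexive (sym (^-distribˡ-+-* Q (level c) (level d)))))
    (λ ()) (λ ())
  ∋-apply shr {x = x} {y} p q = member
    (λ t → ≤-trans x/2^y≤x (as-narrow p t))
    (λ t → ≤-trans x/2^y≤x (as-big p t))
    (λ t → ≤-trans (^-monoʳ-≤ 2 x/2^y≤x) (as-shift p t))
    where
    x/2^y≤x : x ≫ y ≤ x
    x/2^y≤x = m/n≤m x (2 ^ y) {{m^n≢0 2 y}}

  ∋-joinˡ : ∀ {c d x} → c ∋ x → join c d ∋ x
  ∋-joinˡ {c} {d} p = member
    (λ t → ≤-trans (as-narrow p (proj₁ (T-∧⁻ t))) (^-monoʳ-≤ Q (m≤m⊔n (level c) (level d))))
    (λ t → ≤-trans (as-big p (proj₁ (T-∧⁻ t))) (^-monoʳ-≤ R (m≤m⊔n (level c) (level d))))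
    (λ t → ≤-trans (as-shift p (proj₁ (T-∧⁻ t))) (^-monoʳ-≤ Q (m≤m⊔n (level c) (level d))))

  ∋-joinʳ : ∀ {c d x} → d ∋ x → join c d ∋ x
  ∋-joinʳ {c} {d} p = member
    (λ t → ≤-trans (as-narrow p (proj₂ (T-∧⁻ {narrow? c} t))) (^-monoʳ-≤ Q (m≤n⊔m (level c) (level d))))
    (λ t → ≤-trans (as-big p (proj₂ (T-∧⁻ {big? c} t))) (^-monoʳ-≤ R (m≤n⊔m (level c) (level d))))
    (λ t → ≤-trans (as-shift p (proj₂ (T-∧⁻ {shift? c} t))) (^-monoʳ-≤ Q (m≤n⊔m (level c) (level d))))

  record _⊨_ (σ : State) (Γ : Env) : Set where
    constructor models
    field
      regs-ok   : ∀ r → regClass Γ r ∋ regs σ r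
      arrays-ok : ∀ a j → arrClass Γ a ∋ arrays σ a j

  open _⊨_

  Members : List Class → (ℕ → ℕ) → Set
  Members []       f = ⊤
  Members (c ∷ cs) f = c ∋ f 0 × Members cs (f ∘ suc)

  AllMembers : List Class → (ℕ → ℕ → ℕ) → Set
  AllMembers []       A = ⊤
  AllMembers (c ∷ cs) A = (∀ j → c ∋ A 0 j) × AllMembers cs (A ∘ suc)

  members : ∀ cs {f} → Members cs f → ∀ r → classes cs r ∋ f r
  members []       _        r       = ∋-unbounded
  members (c ∷ cs) (p , ps) zero    = p
  members (c ∷ cs) (p , ps) (suc r) = members cs ps r

  allMembers : ∀ cs {A} → AllMembers cs A → ∀ a j → classes cs a ∋ A a j
  allMembers []       _        a       j = ∋-unbounded
  allMembers (c ∷ cs) (p , ps) zero    j = p j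
  allMembers (c ∷ cs) (p , ps) (suc a) j = allMembers cs ps a j

  ∋-operand : ∀ {Γ σ} → σ ⊨ Γ → ∀ x → operandClass Γ x ∋ eval σ x
  ∋-operand m (lit k)        = member (λ _ → lit-bound k 2≤Q) (λ _ → lit-bound k 2≤R) (λ ())
  ∋-operand m (at (reg r))   = regs-ok m r
  ∋-operand m (at (arr a r)) = arrays-ok m a _

  words-wide : ∀ {c x} → c ∋ x → T (wide? c) → words W x ≲ wordBound c
  words-wide {class true  _    _ _} {x} p _ = ≲-trans (words-mono x) (words-narrow _ (as-narrow p tt))
  words-wide {class false true _ _}     p _ = words-big _ (as-big p tt)

  loc-cost : ∀ {Γ σ} → σ ⊨ Γ → ∀ l → T (locOK Γ l) → locCost σ l ≲ locBound Γ l
  loc-cost m (reg r)   _  = 1≲1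
  loc-cost m (arr a r) ok = words-narrow _ (as-narrow (regs-ok m r) ok)

  operand-cost : ∀ {Γ σ} → σ ⊨ Γ → ∀ x → T (operandOK Γ x) → operandCost σ x ≲ operandBound Γ x
  operand-cost m (lit k) _  = 1≲1
  operand-cost m (at l)  ok = loc-cost m l ok

  op-words : ∀ o {c x} → c ∋ x → T (opOK o c) → opWords o x ≲ wordBound c
  op-words add p ok = words-wide p ok
  op-words sub p ok = words-narrow _ (as-narrow p ok)
  op-words shl p ok = words-narrow _ (as-narrow p ok)
  op-words shr p ok = words-narrow _ (as-narrow p ok)

  test-cost : ∀ {Γ σ} → σ ⊨ Γ → ∀ t → T (testOK Γ t) → testCost σ t ≲ testBound Γ t
  test-cost {Γ} {σ} m (test c x y) ok with T-∧⁻ {operandOK Γ x} ok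
  ... | okx , ok′ with T-∧⁻ {operandOK Γ y} ok′
  ... | oky , okw = operand-cost m x okx +≲ operand-cost m y oky +≲
      (shorter (operandClass Γ x) (operandClass Γ y) (∋-operand m x) (∋-operand m y) okw)
    where
    shorter : ∀ c d {x y} → c ∋ x → d ∋ y → T (wide? c ∨ wide? d) →
      words W x ⊓ words W y ≲ (if wide? c then wordBound c else wordBound d)
    shorter (class true  _     _ _) d {x} {y} p q ok = ≲-trans (m⊓n≤m (words W x) (words W y)) (words-wide p tt)
    shorter (class false true  _ _) d {x} {y} p q ok = ≲-trans (m⊓n≤m (words W x) (words W y)) (words-wide p tt)
    shorter (class false false _ _) d {x} {y} p q ok = ≲-trans (m⊓n≤n (words W x) (words W y)) (words-wide q ok)

  assign-cost : ∀ {Γ σ} → σ ⊨ Γ → ∀ l o x y → T (programOK (l ≔ o [ x , y ]) Γ) →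
    assignCost σ l o x y ≲ costBound (l ≔ o [ x , y ]) Γ
  assign-cost {Γ} {σ} m l o x y ok with T-∧⁻ {locOK Γ l} ok
  ... | ok₁ , ok with T-∧⁻ {operandOK Γ x} ok
  ... | ok₂ , ok with T-∧⁻ {operandOK Γ y} ok
  ... | ok₃ , ok with T-∧⁻ {opOK o (operandClass Γ x)} ok
  ... | ok₄ , ok with T-∧⁻ {opOK o (operandClass Γ y)} ok
  ... | ok₅ , ok₆ =
    loc-cost m l ok₁ +≲ operand-cost m x ok₂ +≲ operand-cost m y ok₃
    +≲ op-words o (∋-operand m x) ok₄ +≲ op-words o (∋-operand m y) ok₅
    +≲ op-words o (∋-apply o (∋-operand m x) (∋-operand m y)) ok₆

  ⊨-store : ∀ {Γ σ} → σ ⊨ Γ → ∀ l {c v} → c ∋ v → store σ l v ⊨ storeClass Γ l c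
  ⊨-store {Γ} {σ} m (reg r) {c} {v} p = models regs′ (arrays-ok m)
    where
    regs′ : ∀ s → update (regClass Γ) r c s ∋ update (regs σ) r v s
    regs′ s with s ≡ᵇ r
    ... | true  = p
    ... | false = regs-ok m s
  ⊨-store {Γ} {σ} m (arr a r) {c} {v} p = models (regs-ok m) arrays′
    where
    arrays′ : ∀ b j → update (arrClass Γ) a (join (arrClass Γ a) c) b ∋ update (arrays σ) a (update (arrays σ a) (regs σ r) v) b j
    arrays′ b j with b ≡ᵇ a
    ... | true  = update-all (λ _ → join (arrClass Γ a) c ∋_) (λ j → ∋-joinˡ (arrays-ok m a j)) (λ _ → ∋-joinʳ {arrClass Γ a} p) j
    ... | false = arrays-ok m b j

  -- The bounds below are in units of ℓ.
  Runs : Program → State → ℕ → (State → Set) → Set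
  Runs p σ b Post = ∃[ τ ] ∃[ k ] (Exec p σ τ k × k ≲ b × Post τ)

  run-straight : ∀ p {Γ σ} → T (programOK p Γ) → σ ⊨ Γ → Runs p σ (costBound p Γ) (λ τ → τ ≡ run p σ × τ ⊨ after p Γ)
  run-straight skip ok m = _ , _ , skip , 1≲1 , refl , m
  run-straight (l ≔ o [ x , y ]) ok m =
    _ , _ , assign , assign-cost m l o x y ok , refl , ⊨-store m l (∋-apply o (∋-operand m x) (∋-operand m y))
  run-straight (p ⨾ q) {Γ} ok m with T-∧⁻ {programOK p Γ} ok
  ... | okp , okq with run-straight p okp m
  ... | τ , k , e , k≤ , refl , m′ with run-straight q okq m′
  ... | υ , k′ , e′ , k′≤ , refl , m″ = υ , _ , seq e e′ , k≤ +≲ k′≤ , refl , m″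
  run-straight (ifP c then p else q) {Γ} {σ} ok m with T-∧⁻ {testOK Γ c} ok
  ... | okc , ok′ with T-∧⁻ {programOK p Γ} ok′ | holds σ c in h
  ... | okp , okq | true with run-straight p okp m
  ...   | τ , k , e , k≤ , τ≡ , m′ = τ , _ , if-true h e ,
    test-cost m c okc +≲ ≲-weaken (m≤m+n (costBound p Γ) (costBound q Γ)) k≤ ,
    τ≡ , models (λ r → ∋-joinˡ (regs-ok m′ r)) (λ a j → ∋-joinˡ (arrays-ok m′ a j))
  run-straight (ifP c then p else q) {Γ} {σ} ok m | okc , ok′ | okp , okq | false with run-straight q okq m
  ...   | τ , k , e , k≤ , τ≡ , m′ = τ , _ , if-false h e ,
    test-cost m c okc +≲ ≲-weaken (m≤n+m (costBound q Γ) (costBound p Γ)) k≤ ,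
    τ≡ , models (λ r → ∋-joinʳ {regClass (after p Γ) r} (regs-ok m′ r)) (λ a j → ∋-joinʳ {arrClass (after p Γ) a} (arrays-ok m′ a j))

  runs-straight : ∀ p {Γ σ} {Post : State → Set} → T (programOK p Γ) → σ ⊨ Γ → Yields p σ Post → Runs p σ (costBound p Γ) Post
  runs-straight p ok m (yields post) with run-straight p ok m
  ... | τ , k , e , k≤ , refl , _ = τ , k , e , k≤ , post

  runs-weaken : ∀ {p σ b b′} {Post Post′ : State → Set} → b ≤ b′ → (∀ {τ} → Post τ → Post′ τ) → Runs p σ b Post → Runs p σ b′ Post′
  runs-weaken b≤ f (τ , k , e , k≤ , post) = τ , k , e , ≲-weaken b≤ k≤ , f post

  runs-seq : ∀ {p q σ a b} {Mid Post : State → Set} → Runs p σ a Mid → (∀ {τ} → Mid τ → Runs q τ b Post) → Runs (p ⨾ q) σ (a + b) Post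
  runs-seq {a = a} (τ , k , e , k≤ , mid) f with f mid
  ... | υ , k′ , e′ , k′≤ , post = υ , k + k′ , seq e e′ , k≤ +≲ k′≤ , post

  runs-if : ∀ {c p q σ a b} {Post : State → Set} → testCost σ c ≲ a →
    (holds σ c ≡ true → Runs p σ b Post) → (holds σ c ≡ false → Runs q σ b Post) →
    Runs (ifP c then p else q) σ (a + b) Post
  runs-if {c} {σ = σ} {a} cost f g with holds σ c in h
  ... | true  with f refl
  ...   | τ , k , e , k≤ , post = τ , _ , if-true h e , cost +≲ k≤ , post
  runs-if {c} {σ = σ} {a} cost f g | false with g refl
  ...   | τ , k , e , k≤ , post = τ , _ , if-false h e , cost +≲ k≤ , post

  runs-while : ∀ {c p a b} (I : ℕ → State → Set) →
    (∀ {f σ} → I f σ → testCost σ c ≲ a) →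
    (∀ {f σ} → I (suc f) σ → holds σ c ≡ true → Runs p σ b (I f)) →
    (∀ {σ} → I 0 σ → holds σ c ≡ false) →
    ∀ f {σ} → I f σ → Runs (while c loop p) σ (f * (a + b) + a) (λ τ → (∃[ f′ ] I f′ τ) × holds τ c ≡ false)
  runs-while {c} {a = a} {b} I cost body stop f {σ} i with holds σ c in h
  ... | false = σ , _ , while-false h , ≲-weaken (m≤n+m a (f * (a + b))) (cost i) , (f , i) , h
  runs-while {c} I cost body stop zero {σ} i | true with () ← trans (sym h) (stop i)
  runs-while {c} {a = a} {b} I cost body stop (suc f) {σ} i | true with body i h
  ... | τ , k , e , k≤ , i′ with runs-while I cost body stop f i′
  ... | υ , k′ , e′ , k′≤ , post = υ , _ , while-true h e e′ ,
    ≲-weaken (≤-reflexive (sym (+-assoc (a + b) (f * (a + b)) a))) (cost i +≲ k≤ +≲ k′≤) , post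

-- Merging a step function with its translate

update-same : ∀ {A : Set} (f : ℕ → A) i x → update f i x i ≡ x
update-same f i x with i ≡ᵇ i | ≡⇒≡ᵇ i i refl
... | true | _ = refl

update-other : ∀ {A : Set} (f : ℕ → A) {i j} x → j ≢ i → update f i x j ≡ f j
update-other f {i} {j} x j≢i with j ≡ᵇ i | ≡ᵇ⇒≡ j i
... | true  | j≡i = ⊥-elim (j≢i (j≡i tt))
... | false | _   = refl

-- The counting function s of the items processed so far is stored as a step
-- function: the entry i of a segment of the arrays B and V says that the code
-- V i approximates s c for B i ≤ c < B (i + 1).
module Segments (k C : ℕ) where

  open Codes k

  record Steps (s : ℕ → ℕ) (m lo hi : ℕ) (B V : ℕ → ℕ) : Set where
    constructor steps
    field
      increasing : ∀ {i} → lo ≤ i → i < hi → B i < B (suc i)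
      step-good  : ∀ {i c} → lo ≤ i → i < hi → B i ≤ c → c < B (suc i) → Good m (V i) (s c)

  record Segment (s : ℕ → ℕ) (m lo hi : ℕ) (B V : ℕ → ℕ) : Set where
    constructor segment
    field
      lo<hi   : lo < hi
      first   : B lo ≡ 0
      last    : B hi ≡ suc C
      entries : Steps s m lo hi B V
    open Steps entries public

  steps-agree : ∀ {s m lo hi B V B′ V′} → (∀ {i} → i ≤ hi → B′ i ≡ B i) → (∀ {i} → i < hi → V′ i ≡ V i) →
    Steps s m lo hi B V → Steps s m lo hi B′ V′
  steps-agree B≡ V≡ (steps inc gd) = steps
    (λ lo≤i i<hi → subst₂ _<_ (sym (B≡ (<⇒≤ i<hi))) (sym (B≡ i<hi)) (inc lo≤i i<hi))
    (λ lo≤i i<hi Bi≤c c<B → subst (λ z → Good _ z _) (sym (V≡ i<hi))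
      (gd lo≤i i<hi (subst (_≤ _) (B≡ (<⇒≤ i<hi)) Bi≤c) (subst (_ <_) (B≡ i<hi) c<B)))

  steps-update : ∀ {s m lo hi B V h x y} → hi < h → Steps s m lo hi B V → Steps s m lo hi (update B h x) (update V h y)
  steps-update {B = B} {V} {x = x} {y} hi<h = steps-agree
    (λ i≤hi → update-other B x (<⇒≢ (≤-<-trans i≤hi hi<h)))
    (λ i<hi → update-other V y (<⇒≢ (<-trans i<hi hi<h)))

  segment-update : ∀ {s m lo hi B V h x y} → hi < h → Segment s m lo hi B V → Segment s m lo hi (update B h x) (update V h y)
  segment-update {B = B} {x = x} hi<h (segment lo<hi first last ent) = segment lo<hi
    (trans (update-other B x (<⇒≢ (<-trans lo<hi hi<h))) first)
    (trans (update-other B x (<⇒≢ hi<h)) last)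
    (steps-update hi<h ent)

  steps-snoc : ∀ {s m lo h B V} → Steps s m lo h B V → B h < B (suc h) →
    (∀ {c} → B h ≤ c → c < B (suc h) → Good m (V h) (s c)) → Steps s m lo (suc h) B V
  steps-snoc {s} {m} {lo} {h} {B} {V} (steps inc gd) B<B g = steps
    (λ {i} lo≤i i<1+h → inc′ i lo≤i (m≤n⇒m<n∨m≡n (s≤s⁻¹ i<1+h)))
    (λ {i} lo≤i i<1+h → gd′ i lo≤i (m≤n⇒m<n∨m≡n (s≤s⁻¹ i<1+h)))
    where
    inc′ : ∀ i → lo ≤ i → i < h ⊎ i ≡ h → B i < B (suc i)
    inc′ i lo≤i (inj₁ i<h)  = inc lo≤i i<h
    inc′ i lo≤i (inj₂ refl) = B<B
    gd′ : ∀ i → lo ≤ i → i < h ⊎ i ≡ h → ∀ {c} → B i ≤ c → c < B (suc i) → Good m (V i) (s c)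
    gd′ i lo≤i (inj₁ i<h)  = gd lo≤i i<h
    gd′ i lo≤i (inj₂ refl) = g

  module Merging (s : ℕ → ℕ) (s-mono : ∀ {b c} → b ≤ c → s b ≤ s c) (m wt X lo hi new : ℕ)
                 (codes≤X : (2 + m) * M ≤ X) where

    s⁺ : ℕ → ℕ
    s⁺ c = s c + shifted wt s c

    s⁺-mono : ∀ {b c} → b ≤ c → s⁺ b ≤ s⁺ c
    s⁺-mono b≤c = +-mono-≤ (s-mono b≤c) (shifted-mono wt s-mono b≤c)

    -- The next breakpoint b of c ↦ s (c − d), from the entry i of the segment,
    -- and its code z from e up to there.
    record Cursor (d i b z e : ℕ) (B : ℕ → ℕ) : Set where
      constructor cursor
      field
        lo≤i   : lo ≤ i
        i≤hi   : i ≤ hi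
        b≡     : b ≡ d + B i
        z≤X    : z ≤ X
        z-good : ∀ {c} → e ≤ c → c < b → Good m z (shifted d s c)

    open Cursor public

    cursor-later : ∀ {d i b z e e′ B} → e ≤ e′ → Cursor d i b z e B → Cursor d i b z e′ B
    cursor-later e≤e′ (cursor lo≤i i≤hi b≡ z≤X gd) = cursor lo≤i i≤hi b≡ z≤X λ e′≤c → gd (≤-trans e≤e′ e′≤c)

    cursor-update : ∀ {d i b z e B h x} → hi < h → Cursor d i b z e B → Cursor d i b z e (update B h x)
    cursor-update {d} {B = B} {x = x} hi<h (cursor lo≤i i≤hi b≡ z≤X gd) = cursor lo≤i i≤hi
      (trans b≡ (cong (d +_) (sym (update-other B x (<⇒≢ (≤-<-trans i≤hi hi<h)))))) z≤X gd

    advance : ∀ {d i b z e B V} → Segment s m lo hi B V → (∀ j → V j ≤ X) → e ≤ C →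
      Cursor d i b z e B → e ≤ b → b ≤ e →
      i < hi × Cursor d (suc i) (d + B (suc i)) (V i) e B × e < d + B (suc i)
    advance {d} {i} {b} {z} {e} {B} {V} seg V≤X e≤C cur e≤b b≤e =
      i<hi , cursor (≤-trans (lo≤i cur) (n≤1+n i)) i<hi refl (V≤X i) good′ ,
      subst (_< d + B (suc i)) (sym e≡) (+-monoʳ-< d (increasing (lo≤i cur) i<hi))
      where
      open Segment seg
      e≡ : e ≡ d + B i
      e≡ = trans (≤-antisym e≤b b≤e) (b≡ cur)
      i<hi : i < hi
      i<hi = ≤∧≢⇒< (i≤hi cur) λ { refl → <⇒≱ (s≤s e≤C) (begin
        suc C       ≡⟨ last ⟨
        B hi        ≤⟨ m≤n+m (B hi) d ⟩
        d + B hi    ≡⟨ e≡ ⟨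
        e           ∎) }
        where open ≤-Reasoning
      good′ : ∀ {c} → e ≤ c → c < d + B (suc i) → Good m (V i) (shifted d s c)
      good′ {c} e≤c c<b = subst (Good m (V i)) (sym (shifted-≤ s d≤c)) (step-good (lo≤i cur) i<hi
        (subst (_≤ c ∸ d) (m+n∸m≡n d (B i)) (∸-monoˡ-≤ d Bi≤c))
        (+-cancelˡ-< d _ _ (subst (_< d + B (suc i)) (sym (m+[n∸m]≡n d≤c)) c<b)))
        where
        Bi≤c : d + B i ≤ c
        Bi≤c = ≤-trans (≤-reflexive (sym e≡)) e≤c
        d≤c : d ≤ c
        d≤c = ≤-trans (m≤m+n d (B i)) Bi≤c

    data Output (h next e : ℕ) (B V : ℕ → ℕ) : Set where
      none : h ≡ new → next ≡ 0 → e ≡ 0 → Output h next e B V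
      some : ∀ g → h ≡ suc g → next ≡ suc (V g) → new ≤ g → B new ≡ 0 → Steps s⁺ (suc m) new g B V →
        B g ≤ C → B g < e → (∀ {c} → B g ≤ c → c < e → Good (suc m) (V g) (s⁺ c)) → Output h next e B V

    output-new≤h : ∀ {h next e B V} → Output h next e B V → new ≤ h
    output-new≤h (none refl _ _)                 = ≤-refl
    output-new≤h (some g refl _ new≤g _ _ _ _ _) = ≤-trans new≤g (n≤1+n g)

    output-extend : ∀ {h next e e′ B V r} → Output h next e B V → r < next → e < e′ →
      (∀ {c} → e ≤ c → c < e′ → Good (suc m) r (s⁺ c)) → Output h next e′ B V
    output-extend (none _ refl _) () e<e′ r-good
    output-extend {h} {next} {e} {e′} {B} {V} {r} (some g h≡ refl new≤g first stp B≤C B<e gd) (s≤s r≤) e<e′ r-good =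
      some g h≡ refl new≤g first stp B≤C (<-trans B<e e<e′) good′
      where
      good′ : ∀ {c} → B g ≤ c → c < e′ → Good (suc m) (V g) (s⁺ c)
      good′ {c} B≤c c<e′ with c <? e
      ... | yes c<e = gd B≤c c<e
      ... | no  c≮e = good-between (gd ≤-refl B<e) (s⁺-mono B≤c) r≤ (r-good (≮⇒≥ c≮e) c<e′)

    output-append : ∀ {h next e e′ B V r} → Output h next e B V → e ≤ C → e < e′ →
      (∀ {c} → e ≤ c → c < e′ → Good (suc m) r (s⁺ c)) →
      Output (suc h) (suc r) e′ (update B h e) (update V h r)
    output-append {h} {next} {e} {e′} {B} {V} {r} out e≤C e<e′ r-good =
      some h refl (cong suc (sym (update-same V h r))) (output-new≤h out) (first′ out) (steps′ out)
        (subst (_≤ C) (sym (update-same B h e)) e≤C)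
        (subst (_< e′) (sym (update-same B h e)) e<e′)
        (λ B≤c c<e′ → subst (λ z → Good (suc m) z _) (sym (update-same V h r))
          (r-good (subst (_≤ _) (update-same B h e) B≤c) c<e′))
      where
      B′ V′ : ℕ → ℕ
      B′ = update B h e
      V′ = update V h r
      first′ : Output h next e B V → B′ new ≡ 0
      first′ (none refl _ refl)                 = update-same B h 0
      first′ (some g refl _ new≤g first _ _ _ _) = trans (update-other B e (<⇒≢ (s≤s new≤g))) first
      steps′ : Output h next e B V → Steps s⁺ (suc m) new h B′ V′
      steps′ (none refl _ _) = steps (λ lo≤i i<h → ⊥-elim (<⇒≱ i<h lo≤i)) (λ lo≤i i<h → ⊥-elim (<⇒≱ i<h lo≤i))
      steps′ (some g refl _ new≤g _ stp B≤C B<e gd) = steps-snoc (steps-update ≤-refl stp)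
        (subst₂ _<_ (sym Bg≡) (sym (update-same B h e)) B<e)
        (λ B≤c c<B → subst (λ z → Good (suc m) z _) (sym (update-other V r (<⇒≢ ≤-refl)))
          (gd (subst (_≤ _) Bg≡ B≤c) (subst (_ <_) (update-same B h e) c<B)))
        where
        Bg≡ : B′ g ≡ B g
        Bg≡ = update-other B e (<⇒≢ ≤-refl)

    output-finish : ∀ {h next e B V} → Output h next e B V → C < e → Segment s⁺ (suc m) new h (update B h (suc C)) V
    output-finish (none _ _ refl) ()
    output-finish {h} {next} {e} {B} {V} (some g refl _ new≤g first stp B≤C B<e gd) C<e = segment (s≤s new≤g)
      (trans (update-other B (suc C) (<⇒≢ (s≤s new≤g))) first)
      (update-same B h (suc C))
      (steps-snoc (steps-agree (λ i≤g → update-other B (suc C) (<⇒≢ (s≤s i≤g))) (λ _ → refl) stp)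
        (subst₂ _<_ (sym Bg≡) (sym (update-same B h (suc C))) (s≤s B≤C))
        (λ B≤c c<B → gd (subst (_≤ _) Bg≡ B≤c) (<-≤-trans (subst (_ <_) (update-same B h (suc C)) c<B) C<e)))
      where
      Bg≡ : update B h (suc C) g ≡ B g
      Bg≡ = update-other B (suc C) (<⇒≢ ≤-refl)

-- The program

≤ᵇ-true : ∀ {x y} → (x ≤ᵇ y) ≡ true → x ≤ y
≤ᵇ-true {x} {y} h = ≤ᵇ⇒≤ x y (subst T (sym h) tt)

≤ᵇ-false : ∀ {x y} → (x ≤ᵇ y) ≡ false → y < x
≤ᵇ-false h = ≰⇒> λ x≤y → subst T h (≤⇒≤ᵇ x≤y)

<ᵇ-true : ∀ {x y} → (x <ᵇ y) ≡ true → x < y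
<ᵇ-true {x} {y} h = <ᵇ⇒< x y (subst T (sym h) tt)

<ᵇ-false : ∀ {x y} → (x <ᵇ y) ≡ false → y ≤ x
<ᵇ-false h = ≮⇒≥ λ x<y → subst T h (<⇒<ᵇ x<y)

r : ℕ → Operand
r i = at (reg i)

-- Registers: 3 k, 5 C + 1, 6 number of items left, 7 and 8 the current segment
-- of arrays 2 (B) and 3 (V), 9 weight, 10 and 11 cursors, 12 and 13 end and
-- start of the new segment, 14 and 15 the breakpoints at the cursors, 16 their
-- minimum, 17 and 18 the current codes, 19 one more than the last code written,
-- 27 the sum of the codes, 29 k + 1.  The others are temporary.

advanceX advanceY addCodes emit nextEvent step : Program
advanceX = ifP test le (r 14) (r 16)
  then (reg 17 ≔ add [ lit 0 , at (arr 3 10) ] ⨾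
        reg 10 ≔ add [ lit 1 , r 10 ] ⨾
        reg 14 ≔ add [ lit 0 , at (arr 2 10) ])
  else skip
advanceY = ifP test le (r 15) (r 16)
  then (reg 18 ≔ add [ lit 0 , at (arr 3 11) ] ⨾
        reg 11 ≔ add [ lit 1 , r 11 ] ⨾
        reg 15 ≔ add [ r 9 , at (arr 2 11) ])
  else skip
addCodes =
  reg 20 ≔ shr [ r 17 , r 3 ] ⨾
  reg 20 ≔ sub [ r 20 , lit 1 ] ⨾
  reg 21 ≔ shr [ r 18 , r 3 ] ⨾
  reg 21 ≔ sub [ r 21 , lit 1 ] ⨾
  reg 22 ≔ sub [ r 21 , r 20 ] ⨾
  reg 22 ≔ add [ r 20 , r 22 ] ⨾
  reg 23 ≔ shl [ r 20 , r 3 ] ⨾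
  reg 23 ≔ sub [ r 17 , r 23 ] ⨾
  reg 28 ≔ sub [ r 22 , r 20 ] ⨾
  reg 23 ≔ shr [ r 23 , r 28 ] ⨾
  reg 24 ≔ shl [ r 21 , r 3 ] ⨾
  reg 24 ≔ sub [ r 18 , r 24 ] ⨾
  reg 28 ≔ sub [ r 22 , r 21 ] ⨾
  reg 24 ≔ shr [ r 24 , r 28 ] ⨾
  reg 25 ≔ add [ r 23 , r 24 ] ⨾
  reg 26 ≔ shr [ r 25 , r 29 ] ⨾
  reg 27 ≔ add [ r 22 , r 26 ] ⨾
  reg 27 ≔ shl [ r 27 , r 3 ] ⨾
  reg 28 ≔ shr [ r 25 , r 26 ] ⨾
  reg 27 ≔ add [ r 27 , r 28 ]
emit = ifP test le (r 19) (r 27)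
  then (arr 2 12 ≔ add [ lit 0 , r 16 ] ⨾
        arr 3 12 ≔ add [ lit 0 , r 27 ] ⨾
        reg 12 ≔ add [ lit 1 , r 12 ] ⨾
        reg 19 ≔ add [ lit 1 , r 27 ])
  else skip
nextEvent =
  reg 16 ≔ add [ lit 0 , r 14 ] ⨾
  (ifP test lt (r 15) (r 16) then reg 16 ≔ add [ lit 0 , r 15 ] else skip)
step = advanceX ⨾ advanceY ⨾ addCodes ⨾ emit ⨾ nextEvent

stepRegs stepArrays : List Class
stepRegs =
  unbounded ∷ unbounded ∷ big 1 ∷ shift 3 ∷ unbounded ∷ big 1 ∷ unbounded ∷ unbounded ∷ unbounded ∷ big 1 ∷
  narrow 8 ∷ narrow 8 ∷ narrow 10 ∷ unbounded ∷ big 2 ∷ big 2 ∷ big 2 ∷ narrow 5 ∷ narrow 5 ∷ narrow 5 ∷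
  unbounded ∷ unbounded ∷ unbounded ∷ unbounded ∷ unbounded ∷ unbounded ∷ unbounded ∷ unbounded ∷ unbounded ∷ narrow 3 ∷ []
stepArrays = unbounded ∷ unbounded ∷ big 1 ∷ narrow 5 ∷ []

stepEnv : Env
stepEnv = env (classes stepRegs) (classes stepArrays)

stepCost : ℕ
stepCost = costBound step stepEnv

itemTest : Test
itemTest = test le (r 16) (r 2)

start finish item : Program
start =
  reg 10 ≔ add [ lit 0 , r 7 ] ⨾
  reg 11 ≔ add [ lit 0 , r 7 ] ⨾
  reg 13 ≔ add [ lit 1 , r 8 ] ⨾
  reg 12 ≔ add [ lit 0 , r 13 ] ⨾
  reg 14 ≔ add [ lit 0 , at (arr 2 10) ] ⨾
  reg 15 ≔ add [ r 9 , at (arr 2 11) ] ⨾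
  reg 16 ≔ add [ lit 0 , lit 0 ] ⨾
  reg 17 ≔ add [ lit 0 , lit 0 ] ⨾
  reg 18 ≔ add [ lit 0 , lit 0 ] ⨾
  reg 19 ≔ add [ lit 0 , lit 0 ]
finish =
  arr 2 12 ≔ add [ lit 0 , r 5 ] ⨾
  reg 7 ≔ add [ lit 0 , r 13 ] ⨾
  reg 8 ≔ add [ lit 0 , r 12 ]
item = reg 9 ≔ add [ lit 0 , at (arr 0 6) ] ⨾ start ⨾ (while itemTest loop step) ⨾ finish

startRegs finishRegs : List Class
startRegs =
  unbounded ∷ unbounded ∷ unbounded ∷ unbounded ∷ unbounded ∷ unbounded ∷ unbounded ∷ narrow 8 ∷ narrow 8 ∷ big 1 ∷ []
finishRegs =
  unbounded ∷ unbounded ∷ unbounded ∷ unbounded ∷ unbounded ∷ big 1 ∷ unbounded ∷ unbounded ∷ unbounded ∷ unbounded ∷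
  unbounded ∷ unbounded ∷ narrow 10 ∷ narrow 9 ∷ []

startEnv finishEnv : Env
startEnv  = env (classes startRegs) (classes stepArrays)
finishEnv = env (classes finishRegs) (classes [])

-- The analysis does not apply to the copying of the weight, as array 0 may also
-- hold weights above C, which are not big; it takes 9 units.
itemCost : ℕ → ℕ
itemCost f = 9 + (costBound start startEnv +
  (f * (testBound stepEnv itemTest + stepCost) + testBound stepEnv itemTest + costBound finish finishEnv))

heavyTest mainTest digitTest : Test
heavyTest = test le (at (arr 0 6)) (r 2)
mainTest  = test lt (lit 0) (r 6)
digitTest = test lt (r 4) (r 0)

countDown nextItem digitStart digitStep initialise unpack knapsack : Program
countDown = reg 6 ≔ sub [ r 6 , lit 1 ]
nextItem = countDown ⨾ (ifP heavyTest then item else skip)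
digitStart = reg 4 ≔ add [ lit 0 , at (arr 1 3) ]
digitStep =
  reg 3 ≔ add [ lit 1 , r 3 ] ⨾
  reg 4 ≔ add [ r 4 , r 4 ] ⨾
  reg 4 ≔ add [ r 4 , at (arr 1 3) ]
initialise =
  reg 29 ≔ add [ lit 1 , r 3 ] ⨾
  reg 5 ≔ add [ lit 1 , r 2 ] ⨾
  reg 4 ≔ shl [ lit 1 , r 3 ] ⨾
  reg 4 ≔ sub [ r 4 , lit 1 ] ⨾
  reg 6 ≔ add [ lit 0 , r 0 ] ⨾
  reg 7 ≔ add [ lit 0 , lit 0 ] ⨾
  reg 8 ≔ add [ lit 0 , lit 1 ] ⨾
  arr 3 7 ≔ add [ lit 0 , r 4 ] ⨾
  arr 2 7 ≔ add [ lit 0 , lit 0 ] ⨾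
  arr 2 8 ≔ add [ lit 0 , r 5 ]
unpack =
  reg 8 ≔ sub [ r 8 , lit 1 ] ⨾
  reg 17 ≔ add [ lit 0 , at (arr 3 8) ] ⨾
  reg 20 ≔ shr [ r 17 , r 3 ] ⨾
  reg 20 ≔ sub [ r 20 , lit 1 ] ⨾
  reg 23 ≔ shl [ r 20 , r 3 ] ⨾
  reg 23 ≔ sub [ r 17 , r 23 ] ⨾
  reg 0 ≔ add [ lit 0 , r 20 ] ⨾
  reg 1 ≔ add [ lit 0 , r 23 ]
knapsack = digitStart ⨾ (while digitTest loop digitStep) ⨾ initialise ⨾ (while mainTest loop nextItem) ⨾ unpack

mainRegs digitRegs digitArrays unpackRegs : List Class
mainRegs    = unbounded ∷ unbounded ∷ big 1 ∷ unbounded ∷ unbounded ∷ unbounded ∷ narrow 1 ∷ []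
digitRegs   = narrow 1 ∷ unbounded ∷ big 1 ∷ shift 3 ∷ narrow 3 ∷ []
digitArrays = unbounded ∷ narrow 0 ∷ []
unpackRegs  = unbounded ∷ unbounded ∷ unbounded ∷ shift 3 ∷ unbounded ∷ unbounded ∷ unbounded ∷ unbounded ∷ narrow 8 ∷ []

mainEnv digitEnv unpackEnv : Env
mainEnv   = env (classes mainRegs) (classes [])
digitEnv  = env (classes digitRegs) (classes digitArrays)
unpackEnv = env (classes unpackRegs) (classes stepArrays)

nextItemCost : ℕ → ℕ
nextItemCost f = costBound countDown mainEnv + (testBound mainEnv heavyTest + itemCost f)

module Algorithm (w W ℓ : ℕ) .{{_ : NonZero w}} .{{_ : NonZero W}} (w≤W : w ≤ W) (1≤ℓ : 1 ≤ ℓ)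
                 (k C n : ℕ) (a : ℕ → ℕ) where

  open Machine w W ℓ w≤W 1≤ℓ
  open Costs w W
  open Codes k
  open Segments k C

  X : ℕ
  X = suc n * M

  module Bounded (n≤Q : n ≤ Q) (M≤Q³ : M ≤ Q ^ 3) (C<R : C < R) where

    C<R^1 : suc C ≤ R ^ 1
    C<R^1 = ≤-trans C<R (≤-reflexive (sym (*-identityʳ R)))

    1+n≤Q² : suc n ≤ Q ^ 2
    1+n≤Q² = base-+ {a = 0} {1} 2≤Q ≤-refl (≤-trans n≤Q (≤-reflexive (sym (*-identityʳ Q))))

    X≤Q⁵ : X ≤ Q ^ 5
    X≤Q⁵ = ≤-trans (*-mono-≤ 1+n≤Q² M≤Q³) (≤-reflexive (sym (^-distribˡ-+-* Q 2 3)))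

    sizes≤Q⁸ : suc n * suc X ≤ Q ^ 8
    sizes≤Q⁸ = ≤-trans (*-mono-≤ 1+n≤Q² (base-+ {a = 0} {5} 2≤Q ≤-refl X≤Q⁵)) (≤-reflexive (sym (^-distribˡ-+-* Q 2 6)))

    1+k≤Q³ : suc k ≤ Q ^ 3
    1+k≤Q³ = ≤-trans (n<2^n k) M≤Q³

    Constants : State → Set
    Constants σ = regs σ 2 ≡ C × regs σ 3 ≡ k × regs σ 5 ≡ suc C × regs σ 29 ≡ suc k × arrays σ 0 ≡ a

    record Outer (f lo hi : ℕ) (B V : ℕ → ℕ) : Set where
      constructor outer
      field
        l       : ℕ
        l+f≡n   : l + f ≡ n
        seg     : Segment (count a f l) l lo hi B V
        hi≤     : hi ≤ suc l * suc X
        hi≤lo+X : hi ≤ lo + X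
        V≤X     : ∀ j → V j ≤ X
        B≤1+C   : ∀ j → B j ≤ suc C

    -- m items are left, of which f have not been considered yet.
    OuterAt : ℕ → ℕ → State → Set
    OuterAt m f σ = Constants σ × regs σ 6 ≡ m × Outer f (regs σ 7) (regs σ 8) (arrays σ 2) (arrays σ 3)

    -- Merging the segment lo, …, hi, which counts the solutions with the items
    -- after p, with its translate by the weight of the item p.
    module Item (p l lo hi : ℕ) (l<n : l < n) (a≤C : a p ≤ C) (hi≤ : hi ≤ suc l * suc X) where

      new : ℕ
      new = suc hi

      open Merging (count a (suc p) l) (count-mono a (suc p) l) l (a p) X lo hi new (*-monoˡ-≤ M (s≤s l<n))

      record Stored (h next : ℕ) (B V : ℕ → ℕ) : Set where
        constructor stored
        field
          seg    : Segment (count a (suc p) l) l lo hi B V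
          V≤X    : ∀ j → V j ≤ X
          B≤1+C  : ∀ j → B j ≤ suc C
          h≤     : h ≤ new + next
          next≤X : next ≤ X

      record Merge (f i j h bx by e cu cv next : ℕ) (B V : ℕ → ℕ) : Set where
        constructor merge
        field
          str     : Stored h next B V
          x-cur   : Cursor 0 i bx cu e B
          y-cur   : Cursor (a p) j by cv e B
          e≤bx    : e ≤ bx
          e≤by    : e ≤ by
          e≡      : e ≡ bx ⊎ e ≡ by
          out     : Output h next e B V
          measure : (hi ∸ i) + (hi ∸ j) ≤ f

      record AfterX (f i j h bx by e cu cv next : ℕ) (B V : ℕ → ℕ) : Set where
        constructor afterX
        field
          str     : Stored h next B V
          x-cur   : Cursor 0 i bx cu e B
          y-cur   : Cursor (a p) j by cv e B
          e<bx    : e < bx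
          e≤by    : e ≤ by
          e≤C     : e ≤ C
          out     : Output h next e B V
          measure : (hi ∸ i) + (hi ∸ j) ≤ f ⊎ e ≡ by × (hi ∸ i) + (hi ∸ j) ≤ suc f

      record AfterY (f i j h bx by e cu cv next : ℕ) (B V : ℕ → ℕ) : Set where
        constructor afterY
        field
          str     : Stored h next B V
          x-cur   : Cursor 0 i bx cu e B
          y-cur   : Cursor (a p) j by cv e B
          e<bx    : e < bx
          e<by    : e < by
          e≤C     : e ≤ C
          out     : Output h next e B V
          measure : (hi ∸ i) + (hi ∸ j) ≤ f

      record AfterEmit (f i j h bx by e cu cv next : ℕ) (B V : ℕ → ℕ) : Set where
        constructor afterEmit
        field
          str     : Stored h next B V
          x-cur   : Cursor 0 i bx cu e B
          y-cur   : Cursor (a p) j by cv e B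
          e<bx    : e < bx
          e<by    : e < by
          out     : ∀ {e′} → e < e′ → e′ ≤ bx → e′ ≤ by → Output h next e′ B V
          measure : (hi ∸ i) + (hi ∸ j) ≤ f

      Phase : Set₁
      Phase = (f i j h bx by e cu cv next : ℕ) (B V : ℕ → ℕ) → Set

      Fixed : State → Set
      Fixed σ = regs σ 2 ≡ C × regs σ 3 ≡ k × regs σ 5 ≡ suc C × regs σ 6 ≡ p × regs σ 9 ≡ a p ×
                regs σ 13 ≡ new × regs σ 29 ≡ suc k × arrays σ 0 ≡ a

      In : Phase → ℕ → State → Set
      In P f σ = Fixed σ × P f (regs σ 10) (regs σ 11) (regs σ 12) (regs σ 14) (regs σ 15) (regs σ 16)
                             (regs σ 17) (regs σ 18) (regs σ 19) (arrays σ 2) (arrays σ 3)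

      shrinkˡ : ∀ {i x f} → i < hi → (hi ∸ i) + x ≤ suc f → (hi ∸ suc i) + x ≤ f
      shrinkˡ {x = x} {f} i<hi d≤ = s≤s⁻¹ (subst (λ d → d + x ≤ suc f) (+-∸-assoc 1 i<hi) d≤)

      shrinkʳ : ∀ {j x f} → j < hi → x + (hi ∸ j) ≤ suc f → x + (hi ∸ suc j) ≤ f
      shrinkʳ {j} {x} {f} j<hi d≤ = subst (_≤ f) (+-comm (hi ∸ suc j) x)
        (shrinkˡ j<hi (subst (_≤ suc f) (+-comm x (hi ∸ j)) d≤))

      advanceX-runs : ∀ {f σ} → In Merge (suc f) σ → regs σ 16 ≤ C → In AfterX f (run advanceX σ)
      advanceX-runs {f} {σ} (fx , merge str x-cur y-cur e≤bx e≤by e≡ out measure) e≤C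
        with regs σ 14 ≤ᵇ regs σ 16 in h
      ... | true with advance (Stored.seg str) (Stored.V≤X str) e≤C x-cur e≤bx (≤ᵇ-true h)
      ...   | i<hi , x-cur′ , e<bx′ = fx , afterX str x-cur′ y-cur e<bx′ e≤by e≤C out (inj₁ (shrinkˡ i<hi measure))
      advanceX-runs {f} {σ} (fx , merge str x-cur y-cur e≤bx e≤by e≡ out measure) e≤C
          | false = fx , afterX str x-cur y-cur e<bx e≤by e≤C out (inj₂ (only-y e≡ , measure))
        where
        e<bx : regs σ 16 < regs σ 14
        e<bx = ≤ᵇ-false h
        only-y : regs σ 16 ≡ regs σ 14 ⊎ regs σ 16 ≡ regs σ 15 → regs σ 16 ≡ regs σ 15
        only-y (inj₁ e≡bx) = ⊥-elim (<-irrefl e≡bx e<bx)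
        only-y (inj₂ e≡by) = e≡by

      advanceY-runs : ∀ {f σ} → In AfterX f σ → In AfterY f (run advanceY σ)
      advanceY-runs {f} {σ} (fx@(_ , _ , _ , _ , wt≡ , _) , afterX str x-cur y-cur e<bx e≤by e≤C out measure)
        with regs σ 15 ≤ᵇ regs σ 16 in h
      ... | true with advance (Stored.seg str) (Stored.V≤X str) e≤C y-cur e≤by (≤ᵇ-true h)
      ...   | j<hi , y-cur′ , e<by′ = fx , afterY str x-cur
        (subst (λ t → Cursor (a p) (suc (regs σ 11)) (t + next) (arrays σ 3 (regs σ 11)) (regs σ 16) (arrays σ 2)) (sym wt≡) y-cur′)
        e<bx (subst (λ t → regs σ 16 < t + next) (sym wt≡) e<by′) e≤C out (shrunk measure)
        where
        next : ℕ
        next = arrays σ 2 (suc (regs σ 11))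
        shrunk : (hi ∸ regs σ 10) + (hi ∸ regs σ 11) ≤ f ⊎ regs σ 16 ≡ regs σ 15 × (hi ∸ regs σ 10) + (hi ∸ regs σ 11) ≤ suc f →
                 (hi ∸ regs σ 10) + (hi ∸ suc (regs σ 11)) ≤ f
        shrunk (inj₁ m)       = shrinkʳ j<hi (≤-trans m (n≤1+n f))
        shrunk (inj₂ (_ , m)) = shrinkʳ j<hi m
      advanceY-runs {f} {σ} (fx , afterX str x-cur y-cur e<bx e≤by e≤C out measure)
          | false = fx , afterY str x-cur y-cur e<bx e<by e≤C out (kept measure)
        where
        e<by : regs σ 16 < regs σ 15
        e<by = ≤ᵇ-false h
        kept : (hi ∸ regs σ 10) + (hi ∸ regs σ 11) ≤ f ⊎ regs σ 16 ≡ regs σ 15 × (hi ∸ regs σ 10) + (hi ∸ regs σ 11) ≤ suc f →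
               (hi ∸ regs σ 10) + (hi ∸ regs σ 11) ≤ f
        kept (inj₁ m)          = m
        kept (inj₂ (e≡by , _)) = ⊥-elim (<-irrefl e≡by e<by)

      addCodes-runs : ∀ {f σ} → In AfterY f σ → In AfterY f (run addCodes σ)
      addCodes-runs inv = inv

      addCodes-sum : ∀ {f σ} → In AfterY f σ → regs (run addCodes σ) 27 ≡ regs (run addCodes σ) 17 ⊕ regs (run addCodes σ) 18
      addCodes-sum {σ = σ} ((_ , k≡ , _ , _ , _ , _ , 1+k≡ , _) , _) = sum≡ k≡ 1+k≡
        where
        sum≡ : regs σ 3 ≡ k → regs σ 29 ≡ suc k → regs (run addCodes σ) 27 ≡ regs σ 17 ⊕ regs σ 18
        sum≡ k≡ 1+k≡ rewrite k≡ | 1+k≡ = refl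

      emit-runs : ∀ {f σ} → In AfterY f σ → regs σ 27 ≡ regs σ 17 ⊕ regs σ 18 → In AfterEmit f (run emit σ)
      emit-runs {f} {σ} (fx , afterY (stored seg V≤X B≤1+C h≤ next≤X) x-cur y-cur e<bx e<by e≤C out measure) sum≡
        with regs σ 19 ≤ᵇ regs σ 27 in h
      ... | true = fx , afterEmit
        (stored (segment-update (output-new≤h out) seg)
                (update-all (λ _ → _≤ X) V≤X (λ _ → <⇒≤ sum<X))
                (update-all (λ _ → _≤ suc C) B≤1+C (λ _ → ≤-trans e≤C (n≤1+n C)))
                (≤-trans (s≤s (≤-trans h≤ (+-monoʳ-≤ new (≤ᵇ-true h)))) (≤-reflexive (sym (+-suc new _))))
                sum<X)
        (cursor-update (output-new≤h out) x-cur) (cursor-update (output-new≤h out) y-cur) e<bx e<by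
        (λ e<e′ e′≤bx e′≤by → output-append out e≤C e<e′ (λ e≤c c<e′ → sum-good e≤c (<-≤-trans c<e′ e′≤bx) (<-≤-trans c<e′ e′≤by)))
        measure
        where
        sum-good : ∀ {c} → regs σ 16 ≤ c → c < regs σ 14 → c < regs σ 15 → Good (suc l) (regs σ 27) (s⁺ c)
        sum-good e≤c c<bx c<by = subst (λ z → Good (suc l) z _) (sym sum≡) (good-⊕ (z-good x-cur e≤c c<bx) (z-good y-cur e≤c c<by))
        sum<X : regs σ 27 < X
        sum<X = <-≤-trans (good-code (sum-good ≤-refl e<bx e<by)) (*-monoˡ-≤ M (s≤s l<n))
      ... | false = fx , afterEmit (stored seg V≤X B≤1+C h≤ next≤X) x-cur y-cur e<bx e<by
        (λ e<e′ e′≤bx e′≤by → output-extend out (≤ᵇ-false h) e<e′ (λ e≤c c<e′ → subst (λ z → Good (suc l) z _) (sym sum≡)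
          (good-⊕ (z-good x-cur e≤c (<-≤-trans c<e′ e′≤bx)) (z-good y-cur e≤c (<-≤-trans c<e′ e′≤by)))))
        measure

      nextEvent-runs : ∀ {f σ} → In AfterEmit f σ → In Merge f (run nextEvent σ)
      nextEvent-runs {f} {σ} (fx , afterEmit str x-cur y-cur e<bx e<by out measure)
        with regs σ 15 <ᵇ regs σ 14 in h
      ... | true  = fx , merge str (cursor-later (<⇒≤ e<by) x-cur) (cursor-later (<⇒≤ e<by) y-cur)
        (<⇒≤ (<ᵇ-true h)) ≤-refl (inj₂ refl) (out e<by (<⇒≤ (<ᵇ-true h)) ≤-refl) measure
      ... | false = fx , merge str (cursor-later (<⇒≤ e<bx) x-cur) (cursor-later (<⇒≤ e<bx) y-cur)
        ≤-refl (<ᵇ-false h) (inj₁ refl) (out e<bx ≤-refl (<ᵇ-false h)) measure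

      step-runs : ∀ {f σ} → In Merge (suc f) σ → regs σ 16 ≤ C → Yields step σ (In Merge f)
      step-runs {f} {σ} inv e≤C =
        yields-⨾ {advanceX} {Mid = In AfterX f} (yields (advanceX-runs {f} {σ} inv e≤C)) λ {τ} inv →
        yields-⨾ {advanceY} {Mid = In AfterY f} (yields (advanceY-runs {f} {τ} inv)) λ {τ} inv →
        yields-⨾ {addCodes} {Mid = λ τ → In AfterY f τ × regs τ 27 ≡ regs τ 17 ⊕ regs τ 18}
          (yields (addCodes-runs {f} {τ} inv , addCodes-sum {f} {τ} inv)) λ { {τ} (inv , sum≡) →
        yields-⨾ {emit} {Mid = In AfterEmit f} (yields (emit-runs {f} {τ} inv sum≡)) λ {τ} inv →
        yields (nextEvent-runs {f} {τ} inv) }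

      hi≤Q⁸ : hi ≤ Q ^ 8
      hi≤Q⁸ = ≤-trans hi≤ (≤-trans (*-monoˡ-≤ (suc X) (≤-trans l<n (n≤1+n n))) sizes≤Q⁸)

      merge-models : ∀ {f σ} → In Merge f σ → σ ⊨ stepEnv
      merge-models {f} {σ} ((C≡ , k≡ , 1+C≡ , _ , wt≡ , new≡ , 1+k≡ , _) , merge (stored seg V≤X B≤1+C h≤ next≤X) x-cur y-cur e≤bx e≤by _ _ _) =
        models (members stepRegs
          ( ∋-unbounded , ∋-unbounded
          , ∋-big (subst (_≤ R ^ 1) (sym C≡) (≤-trans (n≤1+n C) C<R^1))
          , ∋-shift (subst (λ k → 2 ^ k ≤ Q ^ 3) (sym k≡) M≤Q³)
          , ∋-unbounded
          , ∋-big (subst (_≤ R ^ 1) (sym 1+C≡) C<R^1)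
          , ∋-unbounded , ∋-unbounded , ∋-unbounded
          , ∋-big (subst (_≤ R ^ 1) (sym wt≡) a≤R)
          , ∋-narrow (≤-trans (i≤hi x-cur) hi≤Q⁸)
          , ∋-narrow (≤-trans (i≤hi y-cur) hi≤Q⁸)
          , ∋-narrow (≤-trans h≤ (base-+ {a = 9} {5} 2≤Q (base-+ {a = 0} {8} 2≤Q ≤-refl hi≤Q⁸) (≤-trans next≤X X≤Q⁵)))
          , ∋-unbounded
          , ∋-big bx≤
          , ∋-big (subst (_≤ R ^ 2) (sym (b≡ y-cur)) (base-+ {a = 1} {1} 2≤R a≤R (≤-trans (B≤1+C _) C<R^1)))
          , ∋-big (≤-trans e≤bx bx≤)
          , ∋-narrow (≤-trans (z≤X x-cur) X≤Q⁵)
          , ∋-narrow (≤-trans (z≤X y-cur) X≤Q⁵)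
          , ∋-narrow (≤-trans next≤X X≤Q⁵)
          , ∋-unbounded , ∋-unbounded , ∋-unbounded , ∋-unbounded , ∋-unbounded , ∋-unbounded , ∋-unbounded , ∋-unbounded , ∋-unbounded
          , ∋-narrow (subst (_≤ Q ^ 3) (sym 1+k≡) 1+k≤Q³)
          , tt))
          (allMembers stepArrays
          ( (λ _ → ∋-unbounded) , (λ _ → ∋-unbounded)
          , (λ j → ∋-big (≤-trans (B≤1+C j) C<R^1))
          , (λ j → ∋-narrow (≤-trans (V≤X j) X≤Q⁵))
          , tt))
        where
        a≤R : a p ≤ R ^ 1
        a≤R = ≤-trans a≤C (≤-trans (n≤1+n C) C<R^1)
        bx≤ : regs σ 14 ≤ R ^ 2
        bx≤ = subst (_≤ R ^ 2) (sym (b≡ x-cur)) (≤-trans (≤-trans (B≤1+C _) C<R^1) (^-monoʳ-≤ R {1} {2} (s≤s z≤n)))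

      inner-runs : ∀ f {σ} → In Merge f σ → Runs (while itemTest loop step) σ
        (f * (testBound stepEnv itemTest + stepCost) + testBound stepEnv itemTest)
        (λ τ → (∃[ f′ ] In Merge f′ τ) × holds τ itemTest ≡ false)
      inner-runs = runs-while (In Merge)
        (λ {f} {σ} inv → test-cost (merge-models {f} {σ} inv) itemTest tt)
        (λ {f} {σ} inv h → runs-straight step tt (merge-models {suc f} {σ} inv)
          (step-runs {f} {σ} inv (subst (regs σ 16 ≤_) (proj₁ (proj₁ inv)) (≤ᵇ-true h))))
        (λ {σ} inv → stop {σ} inv)
        where
        stop : ∀ {σ} → In Merge 0 σ → (regs σ 16 ≤ᵇ regs σ 2) ≡ false
        stop {σ} ((C≡ , _) , merge (stored seg _ _ _ _) x-cur y-cur _ _ e≡ _ measure) with regs σ 16 ≤ᵇ regs σ 2 in h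
        ... | false = refl
        ... | true  = ⊥-elim (<⇒≱ (exceeds e≡) (subst (regs σ 16 ≤_) C≡ (≤ᵇ-true h)))
          where
          at-end : ∀ {d i b z} → Cursor d i b z (regs σ 16) (arrays σ 2) → hi ∸ i ≤ 0 → C < b
          at-end {d} {i} {b} cur d≤0 = begin
            suc C               ≡⟨ Segment.last seg ⟨
            arrays σ 2 hi       ≡⟨ cong (arrays σ 2) (≤-antisym (m∸n≡0⇒m≤n (n≤0⇒n≡0 d≤0)) (i≤hi cur)) ⟩
            arrays σ 2 i        ≤⟨ m≤n+m _ d ⟩
            d + arrays σ 2 i    ≡⟨ b≡ cur ⟨
            b                   ∎
            where open ≤-Reasoning
          exceeds : regs σ 16 ≡ regs σ 14 ⊎ regs σ 16 ≡ regs σ 15 → C < regs σ 16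
          exceeds (inj₁ e≡) = subst (C <_) (sym e≡) (at-end x-cur (≤-trans (m≤m+n _ _) measure))
          exceeds (inj₂ e≡) = subst (C <_) (sym e≡) (at-end y-cur (≤-trans (m≤n+m _ _) measure))

      finish-runs : ∀ {f σ} → l + suc p ≡ n → In Merge f σ → C < regs σ 16 → OuterAt p p (run finish σ)
      finish-runs {f} {σ} l+1+p≡n
        ((C≡ , k≡ , 1+C≡ , p≡ , wt≡ , new≡ , 1+k≡ , a≡) , merge (stored seg V≤X B≤1+C h≤ next≤X) _ _ _ _ _ out _) C<e =
        (C≡ , k≡ , 1+C≡ , 1+k≡ , a≡) , p≡ , outer (suc l) (trans (sym (+-suc l p)) l+1+p≡n)
          (subst₂ (λ c new → Segment (count a p (suc l)) (suc l) new (regs σ 12) (update (arrays σ 2) (regs σ 12) c) (arrays σ 3))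
            (sym 1+C≡) (sym new≡) (output-finish out C<e))
          (begin
            regs σ 12                ≤⟨ h≤new+X ⟩
            suc hi + X               ≡⟨ +-comm (suc hi) X ⟩
            X + suc hi               ≡⟨ +-suc X hi ⟩
            suc X + hi               ≤⟨ +-monoʳ-≤ (suc X) hi≤ ⟩
            suc (suc l) * suc X      ∎)
          (subst (λ new → regs σ 12 ≤ new + X) (sym new≡) h≤new+X)
          V≤X
          (update-all (λ _ → _≤ suc C) B≤1+C (λ _ → ≤-reflexive 1+C≡))
        where
        open ≤-Reasoning
        h≤new+X : regs σ 12 ≤ suc hi + X
        h≤new+X = ≤-trans h≤ (+-monoʳ-≤ (suc hi) next≤X)

    start-runs : ∀ {p l σ} (l<n : l < n) (a≤C : a p ≤ C) (hi≤ : regs σ 8 ≤ suc l * suc X) →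
      Constants σ → regs σ 6 ≡ p → regs σ 9 ≡ a p →
      Segment (count a (suc p) l) l (regs σ 7) (regs σ 8) (arrays σ 2) (arrays σ 3) →
      (∀ j → arrays σ 3 j ≤ X) → (∀ j → arrays σ 2 j ≤ suc C) →
      let open Item p l (regs σ 7) (regs σ 8) l<n a≤C hi≤ in
      In Merge ((regs σ 8 ∸ regs σ 7) + (regs σ 8 ∸ regs σ 7)) (run start σ)
    start-runs {p} {l} {σ} l<n a≤C hi≤ (C≡ , k≡ , 1+C≡ , 1+k≡ , a≡) p≡ wt≡ seg V≤X B≤1+C =
      (C≡ , k≡ , 1+C≡ , p≡ , wt≡ , refl , 1+k≡ , a≡) ,
      I.merge (I.stored seg V≤X B≤1+C (m≤m+n _ 0) z≤n)
        (I.cursor ≤-refl (<⇒≤ lo<hi) refl z≤n (λ _ c<B → ⊥-elim (<⇒≱ c<B (subst (_≤ _) (sym first) z≤n))))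
        (I.cursor ≤-refl (<⇒≤ lo<hi) (cong (_+ arrays σ 2 (regs σ 7)) wt≡) z≤n
          (λ _ c<b → subst (Good l 0)
            (sym (shifted-> (count a (suc p) l) (<-≤-trans (subst₂ (λ t b → _ < t + b) wt≡ first c<b) (≤-reflexive (+-identityʳ (a p))))))
            (good-none l)))
        z≤n z≤n (inj₁ (sym first)) (I.none refl refl refl) ≤-refl
      where
      open Segment seg
      module I where
        open Item p l (regs σ 7) (regs σ 8) l<n a≤C hi≤ public
        open Merging (count a (suc p) l) (count-mono a (suc p) l) l (a p) X (regs σ 7) (regs σ 8) new (*-monoˡ-≤ M (s≤s l<n)) public

    copy-weight-runs : ∀ {p σ} → p ≤ Q → a p ≤ C → regs σ 6 ≡ p → arrays σ 0 ≡ a → ∀ {Post} →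
      Yields (reg 9 ≔ add [ lit 0 , at (arr 0 6) ]) σ Post → Runs (reg 9 ≔ add [ lit 0 , at (arr 0 6) ]) σ 9 Post
    copy-weight-runs {p} {σ} p≤Q a≤C refl refl (yields post) = _ , _ , assign ,
      1≲1 +≲ 1≲1 +≲ words-narrow 1 (≤-trans p≤Q (≤-reflexive (sym (*-identityʳ Q))))
      +≲ words-big 0 z≤n +≲ words-big 1 a≤R +≲ words-big 1 a≤R , post
      where
      a≤R : a p ≤ R ^ 1
      a≤R = ≤-trans a≤C (≤-trans (n≤1+n C) C<R^1)

    segment-heavy : ∀ {p l lo hi B V} → C < a p → (∀ j → B j ≤ suc C) →
      Segment (count a (suc p) l) l lo hi B V → Segment (count a p (suc l)) (suc l) lo hi B V
    segment-heavy {p} {l} C<a B≤1+C (segment lo<hi first last (steps inc gd)) = segment lo<hi first last (steps inc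
      (λ lo≤i i<hi B≤c c<B → subst (Good (suc l) _) (sym (count-heavy a p l (≤-<-trans (s≤s⁻¹ (<-≤-trans c<B (B≤1+C _))) C<a)))
        (good-suc (gd lo≤i i<hi B≤c c<B))))

    item-runs : ∀ {p σ} → OuterAt p (suc p) σ → a p ≤ C → Runs item σ (itemCost (X + X)) (OuterAt p p)
    item-runs {p} {σ} ((C≡ , k≡ , 1+C≡ , 1+k≡ , a≡) , p≡ , outer l l+1+p≡n seg hi≤ hi≤lo+X V≤X B≤1+C) a≤C =
      runs-weaken (+-monoʳ-≤ 9 (+-monoʳ-≤ (costBound start startEnv) (+-monoˡ-≤ (costBound finish finishEnv) (+-monoˡ-≤ (testBound stepEnv itemTest)
          (*-monoˡ-≤ (testBound stepEnv itemTest + stepCost) (+-mono-≤ length≤X length≤X)))))) id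
        (runs-seq {Mid = λ τ → τ ≡ run (reg 9 ≔ add [ lit 0 , at (arr 0 6) ]) σ}
          (copy-weight-runs {p} {σ} (≤-trans p≤n n≤Q) a≤C p≡ a≡ (yields refl))
          λ { refl → runs-seq {Mid = In Merge (len + len)}
            (runs-straight start tt start-models (yields (start-runs {p} {l} {run (reg 9 ≔ add [ lit 0 , at (arr 0 6) ]) σ}
              l<n a≤C hi≤ (C≡ , k≡ , 1+C≡ , 1+k≡ , a≡) p≡ weight≡ seg V≤X B≤1+C)))
            λ {τ} inv → runs-seq {Mid = λ τ → (∃[ f ] In Merge f τ) × holds τ itemTest ≡ false} (inner-runs (len + len) {τ} inv)
            λ { {τ} ((f , inv) , h) → runs-straight finish tt (finish-models {f} {τ} inv)
                  (yields (finish-runs {f} {τ} l+1+p≡n inv (subst (_< regs τ 16) (proj₁ (proj₁ inv)) (≤ᵇ-false h)))) } })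
      where
      lo hi len : ℕ
      lo = regs σ 7
      hi = regs σ 8
      len = hi ∸ lo
      weight≡ : arrays σ 0 (regs σ 6) ≡ a p
      weight≡ = trans (cong (arrays σ 0) p≡) (cong (λ b → b p) a≡)
      length≤X : len ≤ X
      length≤X = subst (len ≤_) (m+n∸m≡n lo X) (∸-monoˡ-≤ lo hi≤lo+X)
      p≤n : p ≤ n
      p≤n = ≤-trans (n≤1+n p) (≤-trans (m≤n+m (suc p) l) (≤-reflexive l+1+p≡n))
      l<n : l < n
      l<n = ≤-trans (s≤s (m≤m+n l p)) (≤-reflexive (trans (sym (+-suc l p)) l+1+p≡n))
      open Item p l lo hi l<n a≤C hi≤
      open Merging (count a (suc p) l) (count-mono a (suc p) l) l (a p) X lo hi new (*-monoˡ-≤ M (s≤s l<n))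
      start-models : run (reg 9 ≔ add [ lit 0 , at (arr 0 6) ]) σ ⊨ startEnv
      start-models = models (members startRegs
          ( ∋-unbounded , ∋-unbounded , ∋-unbounded , ∋-unbounded , ∋-unbounded , ∋-unbounded , ∋-unbounded
          , ∋-narrow (≤-trans (<⇒≤ (Segment.lo<hi seg)) hi≤Q⁸)
          , ∋-narrow hi≤Q⁸
          , ∋-big (subst (_≤ R ^ 1) (sym weight≡) (≤-trans a≤C (≤-trans (n≤1+n C) C<R^1)))
          , tt))
        (allMembers stepArrays
          ( (λ _ → ∋-unbounded) , (λ _ → ∋-unbounded)
          , (λ j → ∋-big (≤-trans (B≤1+C j) C<R^1))
          , (λ j → ∋-narrow (≤-trans (V≤X j) X≤Q⁵))
          , tt))
      finish-models : ∀ {f τ} → In Merge f τ → τ ⊨ finishEnv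
      finish-models {f} {τ} ((_ , _ , 1+C≡ , _ , _ , new≡ , _) , merge (stored _ _ _ h≤ next≤X) _ _ _ _ _ _ _) =
        models (members finishRegs
          ( ∋-unbounded , ∋-unbounded , ∋-unbounded , ∋-unbounded , ∋-unbounded
          , ∋-big (subst (_≤ R ^ 1) (sym 1+C≡) C<R^1)
          , ∋-unbounded , ∋-unbounded , ∋-unbounded , ∋-unbounded , ∋-unbounded , ∋-unbounded
          , ∋-narrow (≤-trans h≤ (base-+ {a = 9} {5} 2≤Q new≤Q⁹ (≤-trans next≤X X≤Q⁵)))
          , ∋-narrow (subst (_≤ Q ^ 9) (sym new≡) new≤Q⁹)
          , tt))
        (allMembers [] tt)
        where
        new≤Q⁹ : new ≤ Q ^ 9
        new≤Q⁹ = base-+ {a = 0} {8} 2≤Q ≤-refl hi≤Q⁸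

    nextItem-runs : ∀ {p σ} → OuterAt (suc p) (suc p) σ → Runs nextItem σ (nextItemCost (X + X)) (OuterAt p p)
    nextItem-runs {p} {σ} inv@((C≡ , k≡ , 1+C≡ , 1+k≡ , a≡) , m≡ , out) =
      runs-seq {Mid = OuterAt p (suc p)}
        (runs-straight countDown tt (main-models {σ} (≤-trans (≤-reflexive m≡) 1+p≤n) C≡)
          (yields ((C≡ , k≡ , 1+C≡ , 1+k≡ , a≡) , cong (_∸ 1) m≡ , out)))
        λ {τ} inv′ → choose {τ} inv′
      where
      1+p≤n : suc p ≤ n
      1+p≤n = ≤-trans (m≤n+m (suc p) (Outer.l out)) (≤-reflexive (Outer.l+f≡n out))
      main-models : ∀ {σ} → regs σ 6 ≤ n → regs σ 2 ≡ C → σ ⊨ mainEnv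
      main-models {σ} m≤n C≡ = models (members mainRegs
        ( ∋-unbounded , ∋-unbounded
        , ∋-big (subst (_≤ R ^ 1) (sym C≡) (≤-trans (n≤1+n C) C<R^1))
        , ∋-unbounded , ∋-unbounded , ∋-unbounded
        , ∋-narrow (≤-trans m≤n (≤-trans n≤Q (≤-reflexive (sym (*-identityʳ Q)))))
        , tt)) (allMembers [] tt)
      choose : ∀ {τ} → OuterAt p (suc p) τ →
        Runs (ifP heavyTest then item else skip) τ (testBound mainEnv heavyTest + itemCost (X + X)) (OuterAt p p)
      choose {τ} inv@(consts@(C≡ , k≡ , 1+C≡ , 1+k≡ , a≡) , m≡ , outer l l+f≡n seg hi≤ hi≤lo+X V≤X B≤1+C) = runs-if
        (test-cost (main-models {τ} (≤-trans (≤-reflexive m≡) (≤-trans (n≤1+n p) 1+p≤n)) C≡) heavyTest tt)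
        (λ h → item-runs {p} {τ} inv (subst₂ _≤_ weight≡ C≡ (≤ᵇ-true h)))
        (λ h → τ , 1 , skip , ≲-weaken (s≤s z≤n) 1≲1 ,
          consts , m≡ , outer (suc l) (trans (sym (+-suc l p)) l+f≡n)
            (segment-heavy (subst₂ _<_ C≡ weight≡ (≤ᵇ-false h)) B≤1+C seg)
            (≤-trans hi≤ (*-monoˡ-≤ (suc X) (n≤1+n (suc l)))) hi≤lo+X V≤X B≤1+C)
        where
        weight≡ : arrays τ 0 (regs τ 6) ≡ a p
        weight≡ = trans (cong (arrays τ 0) m≡) (cong (λ b → b p) a≡)

    main-runs : ∀ f {σ} → OuterAt f f σ → Runs (while mainTest loop nextItem) σ
      (f * (testBound mainEnv mainTest + nextItemCost (X + X)) + testBound mainEnv mainTest) (OuterAt 0 0)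
    main-runs f {σ} inv = runs-weaken ≤-refl (λ {τ} → done {τ}) (runs-while (λ f → OuterAt f f)
      (λ {f} {σ} inv → test-cost (main-models {f} {σ} inv) mainTest tt)
      (λ {f} {σ} inv _ → nextItem-runs {f} {σ} inv)
      (λ {σ} (_ , m≡ , _) → cong (0 <ᵇ_) m≡) f {σ} inv)
      where
      main-models : ∀ {f σ} → OuterAt f f σ → σ ⊨ mainEnv
      main-models {f} {σ} ((C≡ , _) , m≡ , out) = models (members mainRegs
        ( ∋-unbounded , ∋-unbounded
        , ∋-big (subst (_≤ R ^ 1) (sym C≡) (≤-trans (n≤1+n C) C<R^1))
        , ∋-unbounded , ∋-unbounded , ∋-unbounded
        , ∋-narrow (subst (_≤ Q ^ 1) (sym m≡)
            (≤-trans (≤-trans (m≤n+m f (Outer.l out)) (≤-reflexive (Outer.l+f≡n out))) (≤-trans n≤Q (≤-reflexive (sym (*-identityʳ Q))))))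
        , tt)) (allMembers [] tt)
      done : ∀ {τ} → (∃[ f ] OuterAt f f τ) × holds τ mainTest ≡ false → OuterAt 0 0 τ
      done ((zero  , inv) , _) = inv
      done {τ} ((suc f , (_ , m≡ , _)) , h) with () ← trans (sym h) (cong (0 <ᵇ_) m≡)

    unpack-runs : ∀ {σ} → OuterAt 0 0 σ → Runs unpack σ (costBound unpack unpackEnv)
      (λ τ → ∃[ z ] (Good n z (count a 0 n C) × regs τ 0 ≡ expo z × regs τ 1 ≡ mant z))
    unpack-runs {σ} ((C≡ , k≡ , _) , _ , outer l l+0≡n seg hi≤ _ V≤X B≤1+C) =
      runs-straight unpack tt unpack-models (yields (z , good-z , expo≡ k≡ , mant≡ k≡))
      where
      open Segment seg
      hi : ℕ
      hi = regs σ 8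
      l≡n : l ≡ n
      l≡n = trans (sym (+-identityʳ l)) l+0≡n
      1+[hi∸1]≡hi : suc (hi ∸ 1) ≡ hi
      1+[hi∸1]≡hi = m+[n∸m]≡n (≤-trans (s≤s z≤n) lo<hi)
      z : ℕ
      z = arrays σ 3 (hi ∸ 1)
      good-z : Good n z (count a 0 n C)
      good-z = subst (λ l → Good l z (count a 0 l C)) l≡n (step-good
        (s≤s⁻¹ (subst (regs σ 7 <_) (sym 1+[hi∸1]≡hi) lo<hi)) (≤-reflexive 1+[hi∸1]≡hi)
        (s≤s⁻¹ (subst (arrays σ 2 (hi ∸ 1) <_) last′
          (increasing (s≤s⁻¹ (subst (regs σ 7 <_) (sym 1+[hi∸1]≡hi) lo<hi)) (≤-reflexive 1+[hi∸1]≡hi))))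
        (≤-reflexive (sym last′)))
        where
        last′ : arrays σ 2 (suc (hi ∸ 1)) ≡ suc C
        last′ = trans (cong (arrays σ 2) 1+[hi∸1]≡hi) last
      expo≡ : regs σ 3 ≡ k → regs (run unpack σ) 0 ≡ expo z
      expo≡ k≡ rewrite k≡ = refl
      mant≡ : regs σ 3 ≡ k → regs (run unpack σ) 1 ≡ mant z
      mant≡ k≡ rewrite k≡ = refl
      unpack-models : σ ⊨ unpackEnv
      unpack-models = models (members unpackRegs
        ( ∋-unbounded , ∋-unbounded , ∋-unbounded
        , ∋-shift (subst (λ k → 2 ^ k ≤ Q ^ 3) (sym k≡) M≤Q³)
        , ∋-unbounded , ∋-unbounded , ∋-unbounded , ∋-unbounded
        , ∋-narrow (≤-trans hi≤ (≤-trans (*-monoˡ-≤ (suc X) (s≤s (≤-reflexive l≡n))) sizes≤Q⁸))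
        , tt))
        (allMembers stepArrays
          ( (λ _ → ∋-unbounded) , (λ _ → ∋-unbounded)
          , (λ j → ∋-big (≤-trans (B≤1+C j) C<R^1))
          , (λ j → ∋-narrow (≤-trans (V≤X j) X≤Q⁵))
          , tt))

total-bound : ∀ A D E F T e t s g h u v k n X → 1 ≤ n → 1 ≤ X → k ≤ X →
  A + ((k * D + E) + (F + ((n * (T + (e + (t + (9 + (s + ((X + X) * g + h + u)))))) + T) + v)))
  ≤ (A + D + E + F + (T + e + t + 9 + s + 2 * g + h + u) + T + v) * (n * X)
total-bound A D E F T e t s g h u v k n@(suc _) X@(suc _) _ _ k≤X = begin
  A + ((k * D + E) + (F + ((n * (T + (e + (t + (9 + (s + ((X + X) * g + h + u)))))) + T) + v)))
    ≤⟨ +-mono-≤ (scale A) (+-mono-≤ (+-mono-≤ (*-monoˡ-≤ D (≤-trans k≤X (m≤n*m X n))) (scale E)) (+-mono-≤ (scale F) (+-mono-≤ (+-mono-≤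
         (*-monoʳ-≤ n (+-mono-≤ (scaleX T) (+-mono-≤ (scaleX e) (+-mono-≤ (scaleX t) (+-mono-≤ (scaleX 9) (+-mono-≤ (scaleX s)
           (+-mono-≤ (+-mono-≤ (≤-refl {(X + X) * g}) (scaleX h)) (scaleX u)))))))) (scale T)) (scale v)))) ⟩
  A * Y + ((Y * D + E * Y) + (F * Y + ((n * (T * X + (e * X + (t * X + (9 * X + (s * X + ((X + X) * g + h * X + u * X)))))) + T * Y) + v * Y)))
    ≡⟨ collect A D E F T e t s g h u v n X ⟩
  (A + D + E + F + (T + e + t + 9 + s + 2 * g + h + u) + T + v) * Y ∎
  where
  open ≤-Reasoning
  Y : ℕ
  Y = n * X
  scale : ∀ c → c ≤ c * Y
  scale c = m≤m*n c Y
  scaleX : ∀ c → c ≤ c * X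
  scaleX c = m≤m*n c X
  collect : ∀ A D E F T e t s g h u v n X →
    A * (n * X) + (((n * X) * D + E * (n * X)) + (F * (n * X) +
    ((n * (T * X + (e * X + (t * X + (9 * X + (s * X + ((X + X) * g + h * X + u * X)))))) + T * (n * X)) + v * (n * X))))
    ≡ (A + D + E + F + (T + e + t + 9 + s + 2 * g + h + u) + T + v) * (n * X)
  collect = solve-∀

knapsackCost : ℕ
knapsackCost =
  costBound digitStart digitEnv + (testBound digitEnv digitTest + costBound digitStep digitEnv) + testBound digitEnv digitTest
  + costBound initialise digitEnv
  + (testBound mainEnv mainTest + costBound countDown mainEnv + testBound mainEnv heavyTest + 9 + costBound start startEnv
     + 2 * (testBound stepEnv itemTest + stepCost) + testBound stepEnv itemTest + costBound finish finishEnv)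
  + testBound mainEnv mainTest + costBound unpack unpackEnv

module Solving (w W ℓ : ℕ) .{{_ : NonZero w}} .{{_ : NonZero W}} (w≤W : w ≤ W) (1≤ℓ : 1 ≤ ℓ)
               (k C n : ℕ) (a d x : ℕ → ℕ) (1≤n : 1 ≤ n)
               (d≤1 : ∀ i → d i ≤ 1) (x-zero : x 0 ≡ d 0) (x-suc : ∀ i → x (suc i) ≡ x i + x i + d (suc i))
               (x<n : ∀ {j} → j < k → x j < n) (n≤x : n ≤ x k) where

  open Machine w W ℓ w≤W 1≤ℓ
  open Costs w W
  open Codes k
  open Segments k C
  open Algorithm w W ℓ w≤W 1≤ℓ k C n a

  module _ (n≤Q : n ≤ Q) (M≤Q³ : M ≤ Q ^ 3) (C<R : C < R) where

    open Bounded n≤Q M≤Q³ C<R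

    Fresh : State → Set
    Fresh σ = regs σ 0 ≡ n × regs σ 2 ≡ C × arrays σ 0 ≡ a × arrays σ 1 ≡ d ×
              (∀ j → arrays σ 2 j ≡ 0) × (∀ j → arrays σ 3 j ≡ 0)

    record Digits (f j y : ℕ) : Set where
      constructor digits
      field
        j+f≡k : j + f ≡ k
        y≡    : y ≡ x j
        y≤    : y ≤ 1 + (n + n)

    DigitsAt : ℕ → State → Set
    DigitsAt f σ = Fresh σ × Digits f (regs σ 3) (regs σ 4)

    n≤Q¹ : n ≤ Q ^ 1
    n≤Q¹ = ≤-trans n≤Q (≤-reflexive (sym (*-identityʳ Q)))

    digit-models : ∀ {j σ} → Fresh σ → regs σ 3 ≡ j → j ≤ k → regs σ 4 ≤ 1 + (n + n) → σ ⊨ digitEnv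
    digit-models {j} {σ} (n≡ , C≡ , _ , d≡ , _) refl j≤k y≤ = models
      (members digitRegs
        ( ∋-narrow (subst (_≤ Q ^ 1) (sym n≡) n≤Q¹)
        , ∋-unbounded
        , ∋-big (subst (_≤ R ^ 1) (sym C≡) (≤-trans (n≤1+n C) C<R^1))
        , ∋-shift (≤-trans (^-monoʳ-≤ 2 j≤k) M≤Q³)
        , ∋-narrow (≤-trans y≤ (base-+ {a = 0} {2} 2≤Q ≤-refl (base-+ {a = 1} {1} 2≤Q n≤Q¹ n≤Q¹)))
        , tt))
      (allMembers digitArrays ((λ _ → ∋-unbounded) , (λ i → ∋-narrow (subst (λ d → d i ≤ 1) (sym d≡) (d≤1 i))) , tt))

    digitStart-runs : ∀ {σ} → Fresh σ → regs σ 3 ≡ 0 → regs σ 4 ≡ 0 → Runs digitStart σ (costBound digitStart digitEnv) (DigitsAt k)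
    digitStart-runs {σ} fr@(_ , _ , _ , d≡ , _) j≡ y≡ = runs-straight digitStart tt
      (digit-models {0} {σ} fr j≡ z≤n (subst (_≤ 1 + (n + n)) (sym y≡) z≤n))
      (yields (fr , digits (cong (_+ k) j≡) (trans value≡ (cong x (sym j≡)))
        (≤-trans (≤-reflexive value≡) (subst (_≤ 1 + (n + n)) (sym x-zero) (≤-trans (d≤1 0) (s≤s z≤n))))))
      where
      value≡ : arrays σ 1 (regs σ 3) ≡ x 0
      value≡ = trans (cong₂ (λ d j → d j) d≡ j≡) (sym x-zero)

    digitStep-runs : ∀ {f σ} → DigitsAt (suc f) σ → holds σ digitTest ≡ true → Runs digitStep σ (costBound digitStep digitEnv) (DigitsAt f)
    digitStep-runs {f} {σ} (fr@(n≡ , _ , _ , d≡ , _) , digits j+f≡k y≡ y≤) h =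
      runs-straight digitStep tt (digit-models {regs σ 3} {σ} fr refl (≤-trans (m≤m+n _ _) (≤-reflexive j+f≡k)) y≤)
        (yields (fr , digits (trans (sym (+-suc (regs σ 3) f)) j+f≡k)
          (trans (cong₂ (λ y d → y + y + d (suc (regs σ 3))) y≡ d≡) (sym (x-suc (regs σ 3))))
          (≤-trans (+-mono-≤ (+-mono-≤ y≤n y≤n) (subst (λ d → d (suc (regs σ 3)) ≤ 1) (sym d≡) (d≤1 _))) (≤-reflexive (+-comm (n + n) 1)))))
      where
      y≤n : regs σ 4 ≤ n
      y≤n = subst (regs σ 4 ≤_) n≡ (<⇒≤ (<ᵇ-true h))

    digits-run : ∀ {σ} → DigitsAt k σ → Runs (while digitTest loop digitStep) σ
      (k * (testBound digitEnv digitTest + costBound digitStep digitEnv) + testBound digitEnv digitTest) (DigitsAt 0)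
    digits-run {σ} inv = runs-weaken ≤-refl (λ {τ} → done {τ}) (runs-while DigitsAt
      (λ { {f} {σ} (fr , digits j+f≡k y≡ y≤) → test-cost
        (digit-models {regs σ 3} {σ} fr refl (≤-trans (m≤m+n _ _) (≤-reflexive j+f≡k)) y≤) digitTest tt })
      (λ {f} {σ} → digitStep-runs {f} {σ})
      (λ {σ} → stop {σ}) k {σ} inv)
      where
      stop : ∀ {σ} → DigitsAt 0 σ → (regs σ 4 <ᵇ regs σ 0) ≡ false
      stop {σ} ((n≡ , _) , digits j+0≡k y≡ _) with regs σ 4 <ᵇ regs σ 0 in h
      ... | false = refl
      ... | true  = ⊥-elim (<⇒≱ (<ᵇ-true h) (subst₂ _≤_ (sym n≡) (trans (cong x (trans (sym j+0≡k) (+-identityʳ _))) (sym y≡)) n≤x))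
      done : ∀ {τ} → (∃[ f ] DigitsAt f τ) × holds τ digitTest ≡ false → DigitsAt 0 τ
      done ((zero , inv) , _) = inv
      done {τ} ((suc f , (n≡ , _) , digits j+f≡k y≡ _) , h) = ⊥-elim (<⇒≱ (x<n (m+1+n≤k j+f≡k)) (subst₂ _≤_ n≡ y≡ (<ᵇ-false h)))
        where
        m+1+n≤k : ∀ {j f} → j + suc f ≡ k → j < k
        m+1+n≤k {j} {f} j+f≡k = ≤-trans (s≤s (m≤m+n j f)) (≤-reflexive (trans (sym (+-suc j f)) j+f≡k))

    1≤X : 1 ≤ X
    1≤X = ≤-trans (m^n>0 2 k) (m≤m+n M (n * M))

    initialise-runs : ∀ {σ} → DigitsAt 0 σ → Runs initialise σ (costBound initialise digitEnv) (OuterAt n n)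
    initialise-runs {σ} (fr@(n≡ , C≡ , a≡ , d≡ , B≡ , V≡) , digits j+0≡k y≡ y≤) =
      runs-straight initialise tt (digit-models {regs σ 3} {σ} fr refl (≤-reflexive k≡) y≤)
        (yields ((C≡ , k≡ , cong suc C≡ , cong suc k≡ , a≡) , n≡ ,
          outer 0 refl (segment (s≤s z≤n) refl (cong suc C≡) (steps increasing good₀)) (s≤s z≤n) 1≤X
            (update-all (λ _ → _≤ X) (λ j → subst (_≤ X) (sym (V≡ j)) z≤n)
              (λ _ → ≤-trans (≤-reflexive start≡) (≤-trans pred[n]≤n (m≤m+n M (n * M)))))
            (update-all (λ _ → _≤ suc C)
              (update-all (λ _ → _≤ suc C) (λ j → subst (_≤ suc C) (sym (B≡ j)) z≤n) (λ _ → z≤n)) (λ _ → ≤-reflexive (cong suc C≡)))))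
      where
      k≡ : regs σ 3 ≡ k
      k≡ = trans (sym (+-identityʳ _)) j+0≡k
      start≡ : 1 * 2 ^ regs σ 3 ∸ 1 ≡ pred M
      start≡ = cong (_∸ 1) (trans (*-identityˡ _) (cong (2 ^_) k≡))
      B′ : ℕ → ℕ
      B′ = update (update (arrays σ 2) 0 0) 1 (1 + regs σ 2)
      increasing : ∀ {i} → 0 ≤ i → i < 1 → B′ i < B′ (suc i)
      increasing {zero} _ _ = s≤s z≤n
      increasing {suc _} _ (s≤s ())
      good₀ : ∀ {i c} → 0 ≤ i → i < 1 → B′ i ≤ c → c < B′ (suc i) → Good 0 (update (arrays σ 3) 0 (1 * 2 ^ regs σ 3 ∸ 1) i) 1
      good₀ {zero} _ _ _ _ = subst (λ z → Good 0 z 1) (sym start≡) good-start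
      good₀ {suc _} _ (s≤s ())

    knapsack-runs : ∀ {σ} → Fresh σ → regs σ 3 ≡ 0 → regs σ 4 ≡ 0 → Runs knapsack σ (knapsackCost * (n * X))
      (λ τ → ∃[ z ] (Good n z (count a 0 n C) × regs τ 0 ≡ expo z × regs τ 1 ≡ mant z))
    knapsack-runs {σ} fr j≡ y≡ = runs-weaken bound id
      (runs-seq {Mid = DigitsAt k} (digitStart-runs {σ} fr j≡ y≡) λ {τ} inv →
       runs-seq {Mid = DigitsAt 0} (digits-run {τ} inv) λ {τ} inv →
       runs-seq {Mid = OuterAt n n} (initialise-runs {τ} inv) λ {τ} inv →
       runs-seq {Mid = OuterAt 0 0} (main-runs n {τ} inv) λ {τ} inv →
       unpack-runs {τ} inv)
      where
      bound = total-bound (costBound digitStart digitEnv) (testBound digitEnv digitTest + costBound digitStep digitEnv)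
        (testBound digitEnv digitTest) (costBound initialise digitEnv) (testBound mainEnv mainTest) (costBound countDown mainEnv)
        (testBound mainEnv heavyTest) (costBound start startEnv) (testBound stepEnv itemTest + stepCost) (testBound stepEnv itemTest)
        (costBound finish finishEnv) (costBound unpack unpackEnv) k n X 1≤n 1≤X
        (≤-trans (<⇒≤ (n<2^n k)) (m≤m+n M (n * M)))

-- Rationals, logarithms and bits

toℚᵘ-fromℕ : ∀ m → ℚ.toℚᵘ (fromℕ m) ℚᵘ.≃ ℚᵘ.mkℚᵘ (ℤ.+ m) 0
toℚᵘ-fromℕ m = ℚ.toℚᵘ-fromℚᵘ (ℚᵘ.mkℚᵘ (ℤ.+ m) 0)

fromℕ-+ : ∀ a b → fromℕ (a + b) ≡ fromℕ a ℚ.+ fromℕ b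
fromℕ-+ a b = ℚ.toℚᵘ-injective (begin
  ℚ.toℚᵘ (fromℕ (a + b))                          ≈⟨ toℚᵘ-fromℕ (a + b) ⟩
  ℚᵘ.mkℚᵘ (ℤ.+ (a + b)) 0                         ≈⟨ ℚᵘ.*≡* (cong (ℤ._* ℤ.+ 1)
    (trans (ℤ.pos-+ a b) (sym (cong₂ ℤ._+_ (ℤ.*-identityʳ (ℤ.+ a)) (ℤ.*-identityʳ (ℤ.+ b)))))) ⟩
  ℚᵘ.mkℚᵘ (ℤ.+ a) 0 ℚᵘ.+ ℚᵘ.mkℚᵘ (ℤ.+ b) 0        ≈⟨ ℚᵘ.+-cong (toℚᵘ-fromℕ a) (toℚᵘ-fromℕ b) ⟨
  ℚ.toℚᵘ (fromℕ a) ℚᵘ.+ ℚ.toℚᵘ (fromℕ b)          ≈⟨ ℚ.toℚᵘ-homo-+ (fromℕ a) (fromℕ b) ⟨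
  ℚ.toℚᵘ (fromℕ a ℚ.+ fromℕ b)                    ∎)
  where open ℚᵘ.≃-Reasoning

fromℕ-* : ∀ a b → fromℕ (a * b) ≡ fromℕ a ℚ.* fromℕ b
fromℕ-* a b = ℚ.toℚᵘ-injective (begin
  ℚ.toℚᵘ (fromℕ (a * b))                          ≈⟨ toℚᵘ-fromℕ (a * b) ⟩
  ℚᵘ.mkℚᵘ (ℤ.+ (a * b)) 0                         ≈⟨ ℚᵘ.*≡* (cong (ℤ._* ℤ.+ 1) (ℤ.pos-* a b)) ⟩
  ℚᵘ.mkℚᵘ (ℤ.+ a) 0 ℚᵘ.* ℚᵘ.mkℚᵘ (ℤ.+ b) 0        ≈⟨ ℚᵘ.*-cong (toℚᵘ-fromℕ a) (toℚᵘ-fromℕ b) ⟨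
  ℚ.toℚᵘ (fromℕ a) ℚᵘ.* ℚ.toℚᵘ (fromℕ b)          ≈⟨ ℚ.toℚᵘ-homo-* (fromℕ a) (fromℕ b) ⟨
  ℚ.toℚᵘ (fromℕ a ℚ.* fromℕ b)                    ∎)
  where open ℚᵘ.≃-Reasoning

fromℕ-mono-≤ : ∀ {a b} → a ≤ b → fromℕ a ℚ.≤ fromℕ b
fromℕ-mono-≤ {a} {b} a≤b = ℚ.toℚᵘ-cancel-≤ (begin
  ℚ.toℚᵘ (fromℕ a)       ≃⟨ toℚᵘ-fromℕ a ⟩
  ℚᵘ.mkℚᵘ (ℤ.+ a) 0      ≤⟨ ℚᵘ.*≤* (subst₂ ℤ._≤_ (sym (ℤ.*-identityʳ (ℤ.+ a))) (sym (ℤ.*-identityʳ (ℤ.+ b))) (ℤ.+≤+ a≤b)) ⟩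
  ℚᵘ.mkℚᵘ (ℤ.+ b) 0      ≃⟨ toℚᵘ-fromℕ b ⟨
  ℚ.toℚᵘ (fromℕ b)       ∎)
  where open ℚᵘ.≤-Reasoning

fromℕ-cancel-≤ : ∀ {a b} → fromℕ a ℚ.≤ fromℕ b → a ≤ b
fromℕ-cancel-≤ {a} {b} a≤b = ℤ.drop‿+≤+ (subst₂ ℤ._≤_ (ℤ.*-identityʳ (ℤ.+ a)) (ℤ.*-identityʳ (ℤ.+ b)) (ℚᵘ.drop-*≤* (begin
  ℚᵘ.mkℚᵘ (ℤ.+ a) 0      ≃⟨ toℚᵘ-fromℕ a ⟨
  ℚ.toℚᵘ (fromℕ a)       ≤⟨ ℚ.toℚᵘ-mono-≤ a≤b ⟩
  ℚ.toℚᵘ (fromℕ b)       ≃⟨ toℚᵘ-fromℕ b ⟩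
  ℚᵘ.mkℚᵘ (ℤ.+ b) 0      ∎)))
  where open ℚᵘ.≤-Reasoning

fromℕ-positive : ∀ m .{{_ : NonZero m}} → ℚ.Positive (fromℕ m)
fromℕ-positive m = ℚ.normalize-pos m 1

fromℕ-nonNegative : ∀ m → ℚ.NonNegative (fromℕ m)
fromℕ-nonNegative m = ℚ.nonNegative (fromℕ-mono-≤ {0} {m} z≤n)

≤-ceiling : ∀ q → q ℚ.≤ fromℕ ℤ.∣ ceiling q ∣
≤-ceiling q = ℚ.toℚᵘ-cancel-≤ (ℚᵘ.≤-respʳ-≃ (ℚᵘ.≃-sym (toℚᵘ-fromℕ ℤ.∣ ceiling q ∣)) (bound q))
  where
  numerator-bound : ∀ n d .{{_ : NonZero d}} → n ℤ.* ℤ.+ 1 ℤ.≤ ℤ.+ ℤ.∣ ℤ.- (ℤ.- n ℤ./ ℤ.+ d) ∣ ℤ.* ℤ.+ d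
  numerator-bound n d = begin
    n ℤ.* ℤ.+ 1                                     ≡⟨ ℤ.*-identityʳ n ⟩
    n                                               ≡⟨ ℤ.neg-involutive n ⟨
    ℤ.- (ℤ.- n)                                     ≤⟨ ℤ.neg-mono-≤ (ℤ.[n/d]*d≤n (ℤ.- n) (ℤ.+ d)) ⟩
    ℤ.- ((ℤ.- n ℤ./ ℤ.+ d) ℤ.* ℤ.+ d)               ≡⟨ ℤ.neg-distribˡ-* (ℤ.- n ℤ./ ℤ.+ d) (ℤ.+ d) ⟩
    ℤ.- (ℤ.- n ℤ./ ℤ.+ d) ℤ.* ℤ.+ d                 ≤⟨ ℤ.*-monoʳ-≤-nonNeg (ℤ.+ d) (≤-∣∣ (ℤ.- (ℤ.- n ℤ./ ℤ.+ d))) ⟩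
    ℤ.+ ℤ.∣ ℤ.- (ℤ.- n ℤ./ ℤ.+ d) ∣ ℤ.* ℤ.+ d       ∎
    where
    open ℤ.≤-Reasoning
    ≤-∣∣ : ∀ i → i ℤ.≤ ℤ.+ ℤ.∣ i ∣
    ≤-∣∣ (ℤ.+ i)  = ℤ.≤-refl
    ≤-∣∣ -[1+ i ] = ℤ.-≤+
  bound : ∀ q → ℚ.toℚᵘ q ℚᵘ.≤ ℚᵘ.mkℚᵘ (ℤ.+ ℤ.∣ ceiling q ∣) 0
  bound (ℚ.mkℚ n@(ℤ.+ zero)   d _) = ℚᵘ.*≤* (numerator-bound n (suc d))
  bound (ℚ.mkℚ n@(ℤ.+ suc _)  d _) = ℚᵘ.*≤* (numerator-bound n (suc d))
  bound (ℚ.mkℚ n@(-[1+ _ ])   d _) = ℚᵘ.*≤* (numerator-bound n (suc d))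

leastBelow-true : ∀ m (p : ℕ → Bool) → p m ≡ true → p (leastBelow m p) ≡ true
leastBelow-true zero    p pm = pm
leastBelow-true (suc m) p pm with p zero in p0
... | true  = p0
... | false = leastBelow-true m (p ∘ suc) pm

leastBelow-least : ∀ m (p : ℕ → Bool) {j} → j < leastBelow m p → p j ≡ false
leastBelow-least (suc m) p {j} j< with p zero in p0
leastBelow-least (suc m) p {zero}  j<       | false = p0
leastBelow-least (suc m) p {suc j} (s≤s j<) | false = leastBelow-least m (p ∘ suc) j<

≤-⌈log⌉ : ∀ {b} q → 2 ≤ b → q ℚ.≤ fromℕ (b ^ ⌈log[ b ] q ⌉)
≤-⌈log⌉ {b} q 2≤b = does-true (q ℚ.≤? _) (leastBelow-true ℤ.∣ ceiling q ∣ (λ k → does (q ℚ.≤? fromℕ (b ^ k)))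
  (dec-true (q ℚ.≤? _) (ℚ.≤-trans (≤-ceiling q) (fromℕ-mono-≤ (≤-trans (<⇒≤ (n<2^n ℤ.∣ ceiling q ∣)) (^-monoˡ-≤ ℤ.∣ ceiling q ∣ 2≤b))))))
  where
  does-true : ∀ {P : Set} (P? : Dec P) → does P? ≡ true → P
  does-true (yes p) _ = p

⌈log⌉-least : ∀ {b} q {j} → j < ⌈log[ b ] q ⌉ → ¬ q ℚ.≤ fromℕ (b ^ j)
⌈log⌉-least {b} q {j} j< q≤
  with () ← trans (sym (leastBelow-least ℤ.∣ ceiling q ∣ (λ k → does (q ℚ.≤? fromℕ (b ^ k))) j<)) (dec-true (q ℚ.≤? _) q≤)

toBits : ∀ t → ℕ → Vec Bool t
toBits zero    x = []
toBits (suc t) x = if 2 ^ t ≤ᵇ x then true ∷ toBits t (x ∸ 2 ^ t) else false ∷ toBits t x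

unsigned-toBits : ∀ t {x} → x < 2 ^ t → unsigned (toBits t x) ≡ x
unsigned-toBits zero    {zero} _ = refl
unsigned-toBits zero    {suc _} (s≤s ())
unsigned-toBits (suc t) {x} x< with 2 ^ t ≤ᵇ x in h
... | false = unsigned-toBits t (≤ᵇ-false h)
... | true  = trans (cong (2 ^ t +_) (unsigned-toBits t x∸<)) (m+[n∸m]≡n (≤ᵇ-true {2 ^ t} h))
  where
  x∸< : x ∸ 2 ^ t < 2 ^ t
  x∸< = +-cancelˡ-< (2 ^ t) _ _ (subst₂ _<_ (sym (m+[n∸m]≡n (≤ᵇ-true {2 ^ t} h))) (cong (2 ^ t +_) (+-identityʳ (2 ^ t))) x<)

fraction-unsigned : ∀ {t} (v : Vec Bool t) → fraction v ℚ.* fromℕ (2 ^ t) ≡ fromℕ (unsigned v)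
fraction-unsigned []                = refl
fraction-unsigned {suc t} (b ∷ v)   = begin
  ½ ℚ.* (digit ℚ.+ f) ℚ.* fromℕ (2 * 2 ^ t)                 ≡⟨ cong (½ ℚ.* (digit ℚ.+ f) ℚ.*_) (fromℕ-* 2 (2 ^ t)) ⟩
  ½ ℚ.* (digit ℚ.+ f) ℚ.* (fromℕ 2 ℚ.* fromℕ (2 ^ t))       ≡⟨ regroup ½ (digit ℚ.+ f) (fromℕ 2) (fromℕ (2 ^ t)) ⟩
  ½ ℚ.* fromℕ 2 ℚ.* ((digit ℚ.+ f) ℚ.* fromℕ (2 ^ t))       ≡⟨ ℚ.*-identityˡ _ ⟩
  (digit ℚ.+ f) ℚ.* fromℕ (2 ^ t)                           ≡⟨ ℚ.*-distribʳ-+ (fromℕ (2 ^ t)) digit f ⟩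
  digit ℚ.* fromℕ (2 ^ t) ℚ.+ f ℚ.* fromℕ (2 ^ t)           ≡⟨ cong₂ ℚ._+_ (digit-scaled b) (fraction-unsigned v) ⟩
  fromℕ (if b then 2 ^ t else 0) ℚ.+ fromℕ (unsigned v)     ≡⟨ fromℕ-+ (if b then 2 ^ t else 0) (unsigned v) ⟨
  fromℕ ((if b then 2 ^ t else 0) + unsigned v)             ∎
  where
  open ≡-Reasoning
  digit f : ℚ
  digit = if b then 1ℚ else 0ℚ
  f = fraction v
  digit-scaled : ∀ b → (if b then 1ℚ else 0ℚ) ℚ.* fromℕ (2 ^ t) ≡ fromℕ (if b then 2 ^ t else 0)
  digit-scaled true  = ℚ.*-identityˡ _
  digit-scaled false = ℚ.*-zeroˡ (fromℕ (2 ^ t))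
  regroup : ∀ a b c d → a ℚ.* b ℚ.* (c ℚ.* d) ≡ a ℚ.* c ℚ.* (b ℚ.* d)
  regroup = solve 4 (λ a b c d → a :* b :* (c :* d) := a :* c :* (b :* d)) refl
    where open ℚ-Solver

value-scaled : ∀ e k {E μ} → E < 2 ^ e → μ < 2 ^ suc k →
  Float.value (float (toBits e E) (toBits (suc k) μ)) ℚ.* fromℕ (2 ^ k) ≡ fromℕ (μ * 2 ^ E)
value-scaled e k {E} {μ} E< μ< = begin
  fromℕ (2 ^ suc (unsigned (toBits e E))) ℚ.* f ℚ.* fromℕ (2 ^ k)     ≡⟨
    cong (λ E → fromℕ (2 ^ suc E) ℚ.* f ℚ.* fromℕ (2 ^ k)) (unsigned-toBits e E<) ⟩
  fromℕ (2 * 2 ^ E) ℚ.* f ℚ.* fromℕ (2 ^ k)                           ≡⟨ cong (λ x → x ℚ.* f ℚ.* fromℕ (2 ^ k)) (fromℕ-* 2 (2 ^ E)) ⟩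
  fromℕ 2 ℚ.* fromℕ (2 ^ E) ℚ.* f ℚ.* fromℕ (2 ^ k)                   ≡⟨ regroup (fromℕ 2) (fromℕ (2 ^ E)) f (fromℕ (2 ^ k)) ⟩
  f ℚ.* (fromℕ 2 ℚ.* fromℕ (2 ^ k)) ℚ.* fromℕ (2 ^ E)                 ≡⟨ cong (λ x → f ℚ.* x ℚ.* fromℕ (2 ^ E)) (fromℕ-* 2 (2 ^ k)) ⟨
  f ℚ.* fromℕ (2 ^ suc k) ℚ.* fromℕ (2 ^ E)                           ≡⟨ cong (ℚ._* fromℕ (2 ^ E))
    (trans (fraction-unsigned (toBits (suc k) μ)) (cong fromℕ (unsigned-toBits (suc k) μ<))) ⟩
  fromℕ μ ℚ.* fromℕ (2 ^ E)                                           ≡⟨ fromℕ-* μ (2 ^ E) ⟨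
  fromℕ (μ * 2 ^ E)                                                   ∎
  where
  open ≡-Reasoning
  f : ℚ
  f = fraction (toBits (suc k) μ)
  regroup : ∀ a b c d → a ℚ.* b ℚ.* c ℚ.* d ≡ c ℚ.* (a ℚ.* d) ℚ.* b
  regroup = solve 4 (λ a b c d → a :* b :* c :* d := c :* (a :* d) :* b) refl
    where open ℚ-Solver

module Ratio (ε : ℚ) .{{ε>0 : ℚ.Positive ε}} where

  p q : ℕ
  p = ℤ.∣ ↥ ε ∣
  q = ↧ₙ ε

  p≢0 : NonZero p
  p≢0 = numerator≢0 ε
    where
    numerator≢0 : ∀ ε .{{_ : ℚ.Positive ε}} → NonZero ℤ.∣ ↥ ε ∣
    numerator≢0 (ℚ.mkℚ (ℤ.+ suc _) _ _) = _

  ε*q≡p : ε ℚ.* fromℕ q ≡ fromℕ p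
  ε*q≡p = scaled ε
    where
    scaled : ∀ ε .{{_ : ℚ.Positive ε}} → ε ℚ.* fromℕ (↧ₙ ε) ≡ fromℕ ℤ.∣ ↥ ε ∣
    scaled ε@(ℚ.mkℚ (ℤ.+ suc m) d _) = ℚ.toℚᵘ-injective (begin
      ℚ.toℚᵘ (ε ℚ.* fromℕ (suc d))                                ≈⟨ ℚ.toℚᵘ-homo-* ε (fromℕ (suc d)) ⟩
      ℚ.toℚᵘ ε ℚᵘ.* ℚ.toℚᵘ (fromℕ (suc d))                        ≈⟨ ℚᵘ.*-congˡ {ℚ.toℚᵘ ε} (toℚᵘ-fromℕ (suc d)) ⟩
      ℚᵘ.mkℚᵘ (ℤ.+ suc m) d ℚᵘ.* ℚᵘ.mkℚᵘ (ℤ.+ suc d) 0            ≈⟨ ℚᵘ.*≡* (ℤ.*-assoc (ℤ.+ suc m) (ℤ.+ suc d) (ℤ.+ 1)) ⟩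
      ℚᵘ.mkℚᵘ (ℤ.+ suc m) 0                                       ≈⟨ toℚᵘ-fromℕ (suc m) ⟨
      ℚ.toℚᵘ (fromℕ (suc m))                                      ∎)
      where open ℚᵘ.≃-Reasoning

  recip*p≡q : ∀ a → fromℕ a ℚ.* recip ε ℚ.* fromℕ p ≡ fromℕ (a * q)
  recip*p≡q a = begin
    fromℕ a ℚ.* recip ε ℚ.* fromℕ p                   ≡⟨ cong (fromℕ a ℚ.* recip ε ℚ.*_) ε*q≡p ⟨
    fromℕ a ℚ.* recip ε ℚ.* (ε ℚ.* fromℕ q)           ≡⟨ regroup (fromℕ a) (recip ε) ε (fromℕ q) ⟩
    fromℕ a ℚ.* (recip ε ℚ.* ε) ℚ.* fromℕ q           ≡⟨ cong (λ x → fromℕ a ℚ.* x ℚ.* fromℕ q) (ℚ.*-inverseˡ ε {{ℚ.pos⇒nonZero ε}}) ⟩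
    fromℕ a ℚ.* 1ℚ ℚ.* fromℕ q                        ≡⟨ cong (ℚ._* fromℕ q) (ℚ.*-identityʳ (fromℕ a)) ⟩
    fromℕ a ℚ.* fromℕ q                               ≡⟨ fromℕ-* a q ⟨
    fromℕ (a * q)                                     ∎
    where
    open ≡-Reasoning
    regroup : ∀ a b c d → a ℚ.* b ℚ.* (c ℚ.* d) ≡ a ℚ.* (b ℚ.* c) ℚ.* d
    regroup = solve 4 (λ a b c d → a :* b :* (c :* d) := a :* (b :* c) :* d) refl
      where open ℚ-Solver

  private instance
    p>0 : ℚ.Positive (fromℕ p)
    p>0 = fromℕ-positive p {{p≢0}}
    q>0 : ℚ.Positive (fromℕ q)
    q>0 = fromℕ-positive q

  ≤-recip : ∀ {a b} → b * p ≤ a * q → fromℕ b ℚ.≤ fromℕ a ℚ.* recip ε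
  ≤-recip {a} {b} b≤a = ℚ.*-cancelʳ-≤-pos (fromℕ p) (subst₂ ℚ._≤_ (fromℕ-* b p) (sym (recip*p≡q a)) (fromℕ-mono-≤ b≤a))

  recip-≤ : ∀ {a b} → a * q ≤ b * p → fromℕ a ℚ.* recip ε ℚ.≤ fromℕ b
  recip-≤ {a} {b} a≤b = ℚ.*-cancelʳ-≤-pos (fromℕ p) (subst₂ ℚ._≤_ (sym (recip*p≡q a)) (fromℕ-* b p) (fromℕ-mono-≤ a≤b))

  recip-≤⁻¹ : ∀ {a b} → fromℕ a ℚ.* recip ε ℚ.≤ fromℕ b → a * q ≤ b * p
  recip-≤⁻¹ {a} {b} a≤b = fromℕ-cancel-≤ (subst₂ ℚ._≤_ (recip*p≡q a) (sym (fromℕ-* b p))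
    (ℚ.*-monoʳ-≤-nonNeg (fromℕ p) {{fromℕ-nonNegative p}} a≤b))

  ≤-*ε : ∀ {a b} → a * q ≤ b * p → fromℕ a ℚ.≤ fromℕ b ℚ.* ε
  ≤-*ε {a} {b} a≤b = ℚ.*-cancelʳ-≤-pos (fromℕ q) (subst₂ ℚ._≤_ (fromℕ-* a q)
    (trans (fromℕ-* b p) (trans (cong (fromℕ b ℚ.*_) (sym ε*q≡p)) (sym (ℚ.*-assoc (fromℕ b) ε (fromℕ q))))) (fromℕ-mono-≤ a≤b))

  p≤q : ε ℚ.≤ 1ℚ → p ≤ q
  p≤q ε≤1 = fromℕ-cancel-≤ (subst₂ ℚ._≤_ ε*q≡p (ℚ.*-identityˡ (fromℕ q)) (ℚ.*-monoʳ-≤-nonNeg (fromℕ q) {{fromℕ-nonNegative q}} ε≤1))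

  leading : ℕ → ℕ
  leading i = p * 2 ^ i / q

  leading-zero : ε ℚ.≤ 1ℚ → leading 0 ≡ binaryDigit ε 0
  leading-zero ε≤1 = sym (m<n⇒m%n≡m (s≤s
    (≤-trans (/-monoˡ-≤ q (≤-trans (≤-reflexive (*-identityʳ p)) (p≤q ε≤1))) (≤-reflexive (n/n≡1 q)))))

  leading-suc : ∀ i → leading (suc i) ≡ leading i + leading i + binaryDigit ε (suc i)
  leading-suc i = begin
    leading (suc i)                                     ≡⟨ m≡m%n+[m/n]*n (leading (suc i)) 2 ⟩
    binaryDigit ε (suc i) + leading (suc i) / 2 * 2     ≡⟨ cong (λ h → binaryDigit ε (suc i) + h * 2) halved ⟩
    binaryDigit ε (suc i) + leading i * 2               ≡⟨ double (binaryDigit ε (suc i)) (leading i) ⟩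
    leading i + leading i + binaryDigit ε (suc i)       ∎
    where
    open ≡-Reasoning
    instance
      2q≢0 : NonZero (q * 2)
      2q≢0 = m*n≢0 q 2
    double : ∀ d x → d + x * 2 ≡ x + x + d
    double = solve-∀
    reorder : ∀ p e → p * (2 * e) ≡ p * e * 2
    reorder = solve-∀
    halved : leading (suc i) / 2 ≡ leading i
    halved = begin
      p * 2 ^ suc i / q / 2            ≡⟨ m/n/o≡m/[n*o] (p * 2 ^ suc i) q 2 ⟩
      p * 2 ^ suc i / (q * 2)          ≡⟨ cong (_/ (q * 2)) (reorder p (2 ^ i)) ⟩
      p * 2 ^ i * 2 / (q * 2)          ≡⟨ m*n/o*n≡m/o (p * 2 ^ i) 2 q ⟩
      leading i                        ∎

<2^bitLength : ∀ x → x < 2 ^ bitLength x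
<2^bitLength x = ≰⇒> λ 2^b≤x → <⇒≱ ≤-refl (subst (_≤ ⌊log₂ x ⌋) (⌊log₂[2^n]⌋≡n (bitLength x)) (⌊log₂⌋-mono-≤ 2^b≤x))

signTest : Test
signTest = test lt (lit 0) (r 1)

answerZero program : Program
answerZero =
  reg 0 ≔ add [ lit 0 , lit 0 ] ⨾
  reg 1 ≔ add [ lit 0 , lit 0 ]
program = ifP signTest then answerZero else knapsack

signRegs : List Class
signRegs = unbounded ∷ narrow 0 ∷ []

signEnv : Env
signEnv = env (classes signRegs) (classes [])

programCost : ℕ
programCost = testBound signEnv signTest + (costBound answerZero signEnv + knapsackCost)

Correct : (n : ℕ) .{{_ : NonZero n}} (ε : ℚ) .{{_ : ℚ.Positive ε}} → Vec ℕ n → ℤ → Set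
Correct n ε w C =
  ∃[ Z ] ∃[ time ]
    (Computes {n} {exponentLength n} {mantissaLength n ε} program w C ε Z time
     × (1ℚ ℚ.- ε) ℚ.* fromℕ (#solutions w C) ℚ.≤ Float.value Z
     × Float.value Z ℚ.≤ fromℕ (#solutions w C)
     × fromℕ time ℚ.≤ fromℕ (programCost * 4) ℚ.* timeBound n ε)

module Solution (n : ℕ) .{{n≢0 : NonZero n}} (ε : ℚ) .{{ε>0 : ℚ.Positive ε}} (ε≤1 : ε ℚ.≤ 1ℚ) (C : ℤ) where

  open Ratio ε

  w W ℓ k : ℕ
  w = bitLength n
  W = bitLength (n ⊔ ℤ.∣ C ∣)
  ℓ = logFactor n ε
  k = ⌈log[ 2 ] fromℕ n ℚ.* recip ε ⌉

  w≤W : w ≤ W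
  w≤W = s≤s (⌊log₂⌋-mono-≤ (m≤m⊔n n ℤ.∣ C ∣))

  1≤ℓ : 1 ≤ ℓ
  1≤ℓ = m≤m⊔n 1 ⌈log[ n ⊔ 2 ] recip ε ⌉

  1≤n : 1 ≤ n
  1≤n = >-nonZero⁻¹ n

  open Machine w W ℓ w≤W 1≤ℓ
  open Codes k

  X : ℕ
  X = suc n * M

  n≤Q : n ≤ Q
  n≤Q = ≤-trans (<⇒≤ (<2^bitLength n)) (^-monoʳ-≤ 2 (≤-trans (≤-reflexive (sym (*-identityʳ w))) (*-monoʳ-≤ w 1≤ℓ)))

  C<R : ℤ.∣ C ∣ < R
  C<R = ≤-<-trans (m≤n⊔m n ℤ.∣ C ∣) (<2^bitLength (n ⊔ ℤ.∣ C ∣))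

  nq≤Mp : n * q ≤ M * p
  nq≤Mp = recip-≤⁻¹ {n} {M} (≤-⌈log⌉ (fromℕ n ℚ.* recip ε) ≤-refl)

  n≤leading : n ≤ leading k
  n≤leading = begin
    n               ≡⟨ m*n/n≡m n q ⟨
    n * q / q       ≤⟨ /-monoˡ-≤ q nq≤Mp ⟩
    M * p / q       ≡⟨ cong (_/ q) (*-comm M p) ⟩
    leading k       ∎
    where open ≤-Reasoning

  leading<n : ∀ {j} → j < k → leading j < n
  leading<n {j} j<k = ≰⇒> λ n≤ → ⌈log⌉-least (fromℕ n ℚ.* recip ε) j<k (recip-≤ {n} {2 ^ j} (begin
    n * q               ≤⟨ *-monoˡ-≤ q n≤ ⟩
    leading j * q       ≤⟨ m/n*n≤m (p * 2 ^ j) q ⟩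
    p * 2 ^ j           ≡⟨ *-comm p (2 ^ j) ⟩
    2 ^ j * p           ∎))
    where open ≤-Reasoning

  Mp≤2nq : M * p ≤ 2 * (n * q)
  Mp≤2nq = by-k k refl
    where
    open ≤-Reasoning
    by-k : ∀ k′ → k ≡ k′ → 2 ^ k′ * p ≤ 2 * (n * q)
    by-k zero    _  = begin
      1 * p         ≡⟨ *-identityˡ p ⟩
      p             ≤⟨ p≤q ε≤1 ⟩
      q             ≤⟨ m≤n*m q n ⟩
      n * q         ≤⟨ m≤n*m (n * q) 2 ⟩
      2 * (n * q)   ∎
    by-k (suc j) k≡ = begin
      2 * 2 ^ j * p                   ≡⟨ *-assoc 2 (2 ^ j) p ⟩
      2 * (2 ^ j * p)                 ≡⟨ cong (2 *_) (*-comm (2 ^ j) p) ⟩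
      2 * (p * 2 ^ j)                 ≤⟨ *-monoʳ-≤ 2 (<⇒≤ (begin-strict
        p * 2 ^ j                     ≡⟨ m≡m%n+[m/n]*n (p * 2 ^ j) q ⟩
        p * 2 ^ j % q + leading j * q <⟨ +-monoˡ-< (leading j * q) (m%n<n (p * 2 ^ j) q) ⟩
        suc (leading j) * q           ≤⟨ *-monoˡ-≤ q (leading<n (≤-reflexive (sym k≡))) ⟩
        n * q                         ∎)) ⟩
      2 * (n * q)                     ∎

  q≤Qp : q ≤ Q * p
  q≤Qp = begin
    q                                           ≡⟨ *-identityˡ q ⟨
    1 * q                                       ≤⟨ recip-≤⁻¹ {1} {b ^ j}
      (subst (ℚ._≤ fromℕ (b ^ j)) (sym (ℚ.*-identityˡ (recip ε))) (≤-⌈log⌉ (recip ε) (m≤n⊔m n 2))) ⟩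
    b ^ j * p                                   ≤⟨ *-monoˡ-≤ p (begin
      b ^ j                                     ≤⟨ ^-monoʳ-≤ b {{>-nonZero (≤-trans (s≤s z≤n) (m≤n⊔m n 2))}} (m≤n⊔m 1 j) ⟩
      b ^ ℓ                                     ≤⟨ ^-monoˡ-≤ ℓ (⊔-lub (<⇒≤ (<2^bitLength n)) (^-monoʳ-≤ 2 {1} {w} (s≤s z≤n))) ⟩
      (2 ^ w) ^ ℓ                               ≡⟨ ^-*-assoc 2 w ℓ ⟩
      Q                                         ∎) ⟩
    Q * p                                       ∎
    where
    open ≤-Reasoning
    b j : ℕ
    b = n ⊔ 2
    j = ⌈log[ b ] recip ε ⌉

  M≤Q³ : M ≤ Q ^ 3
  M≤Q³ = *-cancelʳ-≤ M (Q ^ 3) p {{p≢0}} (begin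
    M * p                   ≤⟨ Mp≤2nq ⟩
    2 * (n * q)             ≤⟨ *-mono-≤ 2≤Q (*-mono-≤ n≤Q q≤Qp) ⟩
    Q * (Q * (Q * p))       ≡⟨ cube Q p ⟩
    Q ^ 3 * p               ∎)
    where
    open ≤-Reasoning
    cube : ∀ Q p → Q * (Q * (Q * p)) ≡ Q * (Q * (Q * 1)) * p
    cube = solve-∀

  Y : ℕ
  Y = n * X

  1≤Y : 1 ≤ Y
  1≤Y = *-mono-≤ 1≤n (≤-trans (m^n>0 2 k) (m≤m+n M (n * M)))

  Yp≤4n³q : Y * p ≤ 4 * n ^ 3 * q
  Yp≤4n³q = begin
    n * (suc n * M) * p             ≡⟨ regroup n (suc n) M p ⟩
    n * suc n * (M * p)             ≤⟨ *-mono-≤ (*-monoʳ-≤ n (+-monoˡ-≤ n 1≤n)) Mp≤2nq ⟩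
    n * (n + n) * (2 * (n * q))     ≡⟨ collect n q ⟩
    4 * n ^ 3 * q                   ∎
    where
    open ≤-Reasoning
    regroup : ∀ a b c d → a * (b * c) * d ≡ a * b * (c * d)
    regroup = solve-∀
    collect : ∀ n q → n * (n + n) * (2 * (n * q)) ≡ 4 * (n * (n * (n * 1))) * q
    collect = solve-∀

  Result : ℕ → State → Set
  Result s τ = ∃[ z ] (Good n z s × regs τ 0 ≡ expo z × regs τ 1 ≡ mant z)

  module _ {z s : ℕ} (g : Good n z s) where

    expo<n : expo z < n
    expo<n = ≤-<-trans
      (∸-monoˡ-≤ 1 (s≤s⁻¹ (*-cancelʳ-< M (z ≫ k) (suc n) (≤-<-trans (≫-lower z k) (good-code g)))))
      (∸-monoʳ-< {n} {1} {0} ≤-refl 1≤n)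

    expo<2^e : expo z < 2 ^ exponentLength n
    expo<2^e = <-≤-trans expo<n (fromℕ-cancel-≤ (≤-⌈log⌉ (fromℕ n) ≤-refl))

    mant<2^t : mant z < 2 ^ mantissaLength n ε
    mant<2^t = Canonical.s<2M (proj₂ (decode z))

    answer : Float (exponentLength n) (mantissaLength n ε)
    answer = float (toBits _ (expo z)) (toBits _ (mant z))

    private
      v S M′ : ℚ
      v  = Float.value answer
      S  = fromℕ s
      M′ = fromℕ M

      v*M≡ : v ℚ.* M′ ≡ fromℕ (val z)
      v*M≡ = value-scaled (exponentLength n) k expo<2^e mant<2^t

      instance
        M>0 : ℚ.Positive M′
        M>0 = fromℕ-positive M

    answer-upper : v ℚ.≤ S
    answer-upper = ℚ.*-cancelʳ-≤-pos M′ (begin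
      v ℚ.* M′            ≡⟨ v*M≡ ⟩
      fromℕ (val z)       ≤⟨ fromℕ-mono-≤ (≤-trans (upper g) (≤-trans (*-monoˡ-≤ s (pred[n]≤n {M})) (≤-reflexive (*-comm M s)))) ⟩
      fromℕ (s * M)       ≡⟨ fromℕ-* s M ⟩
      S ℚ.* M′            ∎)
      where open ℚ.≤-Reasoning

    answer-lower : (1ℚ ℚ.- ε) ℚ.* S ℚ.≤ v
    answer-lower = ℚ.*-cancelʳ-≤-pos M′ (begin
      (1ℚ ℚ.- ε) ℚ.* S ℚ.* M′                                  ≡⟨ expand ε S M′ ⟩
      M′ ℚ.* S ℚ.- M′ ℚ.* ε ℚ.* S                              ≤⟨ ℚ.+-monoˡ-≤ (ℚ.- (M′ ℚ.* ε ℚ.* S)) (begin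
        M′ ℚ.* S                                               ≡⟨ fromℕ-* M s ⟨
        fromℕ (M * s)                                          ≤⟨ fromℕ-mono-≤
          (≤-trans (lower g) (≤-reflexive (cong (λ m → val z + m * s) (m≤n⇒m⊔n≡n 1≤n)))) ⟩
        fromℕ (val z + n * s)                                  ≡⟨ trans (fromℕ-+ (val z) (n * s)) (cong (fromℕ (val z) ℚ.+_) (fromℕ-* n s)) ⟩
        fromℕ (val z) ℚ.+ fromℕ n ℚ.* S                        ≤⟨ ℚ.+-monoʳ-≤ (fromℕ (val z))
          (ℚ.*-monoʳ-≤-nonNeg S {{fromℕ-nonNegative s}} (≤-*ε {n} {M} nq≤Mp)) ⟩
        fromℕ (val z) ℚ.+ M′ ℚ.* ε ℚ.* S                       ∎) ⟩
      fromℕ (val z) ℚ.+ M′ ℚ.* ε ℚ.* S ℚ.- M′ ℚ.* ε ℚ.* S      ≡⟨ cancel (fromℕ (val z)) (M′ ℚ.* ε ℚ.* S) ⟩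
      fromℕ (val z)                                            ≡⟨ v*M≡ ⟨
      v ℚ.* M′                                                 ∎)
      where
      open ℚ.≤-Reasoning
      expand : ∀ e s m → (1ℚ ℚ.- e) ℚ.* s ℚ.* m ≡ m ℚ.* s ℚ.- m ℚ.* e ℚ.* s
      expand = solve 3 (λ e s m → (con 1ℚ :- e) :* s :* m := m :* s :- m :* e :* s) refl
        where open ℚ-Solver
      cancel : ∀ a b → a ℚ.+ b ℚ.- b ≡ a
      cancel = solve 2 (λ a b → a :+ b :- b := a) refl
        where open ℚ-Solver

    answer-outputs : ∀ {τ} → regs τ 0 ≡ expo z → regs τ 1 ≡ mant z → Outputs τ answer
    answer-outputs r₀ r₁ = record
      { exponent-out = trans r₀ (sym (unsigned-toBits (exponentLength n) expo<2^e))
      ; mantissa-out = trans r₁ (sym (unsigned-toBits (mantissaLength n ε) mant<2^t)) }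

  time-bound : ∀ c {t} → t ≤ c * Y * ℓ → fromℕ t ℚ.≤ fromℕ (c * 4) ℚ.* timeBound n ε
  time-bound c {t} t≤ = begin
    fromℕ t                                                                ≤⟨ ≤-recip {c * 4 * n ^ 3 * ℓ} {t} scaled-bound ⟩
    fromℕ (c * 4 * n ^ 3 * ℓ) ℚ.* recip ε                                  ≡⟨ cong (ℚ._* recip ε)
      (trans (fromℕ-* (c * 4 * n ^ 3) ℓ) (cong (ℚ._* fromℕ ℓ) (fromℕ-* (c * 4) (n ^ 3)))) ⟩
    fromℕ (c * 4) ℚ.* fromℕ (n ^ 3) ℚ.* fromℕ ℓ ℚ.* recip ε                ≡⟨ regroupℚ (fromℕ (c * 4)) (fromℕ (n ^ 3)) (fromℕ ℓ) (recip ε) ⟩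
    fromℕ (c * 4) ℚ.* (fromℕ (n ^ 3) ℚ.* recip ε ℚ.* fromℕ ℓ)              ∎
    where
    scaled-bound : t * p ≤ c * 4 * n ^ 3 * ℓ * q
    scaled-bound = begin
      t * p                       ≤⟨ *-monoˡ-≤ p t≤ ⟩
      c * Y * ℓ * p               ≡⟨ regroup c Y ℓ p ⟩
      c * ℓ * (Y * p)             ≤⟨ *-monoʳ-≤ (c * ℓ) Yp≤4n³q ⟩
      c * ℓ * (4 * n ^ 3 * q)     ≡⟨ collect c ℓ (n ^ 3) q ⟩
      c * 4 * n ^ 3 * ℓ * q       ∎
      where
      open ≤-Reasoning
      regroup : ∀ a b c d → a * b * c * d ≡ a * c * (b * d)
      regroup = solve-∀
      collect : ∀ c l m q → c * l * (4 * m * q) ≡ c * 4 * m * l * q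
      collect = solve-∀
    open ℚ.≤-Reasoning
    regroupℚ : ∀ a b c d → a ℚ.* b ℚ.* c ℚ.* d ≡ a ℚ.* (b ℚ.* d ℚ.* c)
    regroupℚ = solve 4 (λ a b c d → a :* b :* c :* d := a :* (b :* d :* c)) refl
      where open ℚ-Solver

  program-bound : ∀ {b} → b ≤ costBound answerZero signEnv + knapsackCost → testBound signEnv signTest + b * Y ≤ programCost * Y
  program-bound {b} b≤ = begin
    testBound signEnv signTest + b * Y                    ≤⟨ +-mono-≤ (m≤m*n (testBound signEnv signTest) Y {{>-nonZero 1≤Y}}) (*-monoˡ-≤ Y b≤) ⟩
    testBound signEnv signTest * Y + (costBound answerZero signEnv + knapsackCost) * Y
                                                          ≡⟨ *-distribʳ-+ Y (testBound signEnv signTest) (costBound answerZero signEnv + knapsackCost) ⟨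
    programCost * Y                                       ∎
    where open ≤-Reasoning

  sign-models : ∀ {σ} → regs σ 1 ≤ 1 → σ ⊨ signEnv
  sign-models s≤1 = models (members signRegs (∋-unbounded , ∋-narrow s≤1 , tt)) (allMembers [] tt)

  Solves : Vec ℕ n → Set
  Solves weights = Runs program (input weights C ε) (programCost * Y) (Result (#solutions weights C))

  conclude : ∀ weights → Solves weights → Correct n ε weights C
  conclude weights (τ , t , exec , scaled t≤ , z , g , r₀ , r₁) =
    answer g , t , (τ , exec , answer-outputs g r₀ r₁) , answer-lower g , answer-upper g , time-bound programCost t≤

nonnegative-runs : ∀ n .{{_ : NonZero n}} ε .{{_ : ℚ.Positive ε}} (ε≤1 : ε ℚ.≤ 1ℚ) c (weights : Vec ℕ n) →
  Solution.Solves n ε ε≤1 (ℤ.+ c) weights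
nonnegative-runs n ε ε≤1 c weights = runs-weaken (program-bound {knapsackCost} (m≤n+m knapsackCost (costBound answerZero signEnv)))
  (λ { (z , g , out) → z , subst (Good n z) (sym (#solutions≡count weights c)) g , out })
  (runs-if (test-cost (sign-models {input weights (ℤ.+ c) ε} z≤n) signTest tt) (λ ())
    (λ _ → knapsack-runs n≤Q M≤Q³ C<R (refl , refl , refl , refl , (λ _ → refl) , (λ _ → refl)) refl refl))
  where
  open Solution n ε ε≤1 (ℤ.+ c)
  open Machine w W ℓ w≤W 1≤ℓ
  open Codes k
  open Ratio ε
  open Solving w W ℓ w≤W 1≤ℓ k c n (listToArray (Vec.toList weights)) (binaryDigit ε) leading 1≤n
    (λ i → s≤s⁻¹ (m%n<n (p * 2 ^ i / q) 2)) (leading-zero ε≤1) leading-suc leading<n n≤leading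

negative-runs : ∀ n .{{_ : NonZero n}} ε .{{_ : ℚ.Positive ε}} (ε≤1 : ε ℚ.≤ 1ℚ) c (weights : Vec ℕ n) →
  Solution.Solves n ε ε≤1 -[1+ c ] weights
negative-runs n ε ε≤1 c weights = runs-weaken
  (≤-trans (+-monoʳ-≤ (testBound signEnv signTest) (m≤m*n (costBound answerZero signEnv) Y {{>-nonZero 1≤Y}}))
    (program-bound {costBound answerZero signEnv} (m≤m+n (costBound answerZero signEnv) knapsackCost))) id
  (runs-if (test-cost σ⊨ signTest tt) (λ _ → runs-straight answerZero tt σ⊨
    (yields (0 , subst (Good n 0) (sym (#solutions-negative weights c)) (good-none n) , sym expo0 , sym mant0))) (λ ()))
  where
  open Solution n ε ε≤1 -[1+ c ]
  open Machine w W ℓ w≤W 1≤ℓ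
  open Codes k
  σ⊨ : input weights -[1+ c ] ε ⊨ signEnv
  σ⊨ = sign-models ≤-refl
  expo0 : expo 0 ≡ 0
  expo0 = cong (_∸ 1) (0/n≡0 M)
  mant0 : mant 0 ≡ 0
  mant0 = 0∸n≡0 (expo 0 * M)

program-correct : (n : ℕ) .{{_ : NonZero n}} (ε : ℚ) .{{_ : ℚ.Positive ε}} → ε ℚ.≤ 1ℚ → ∀ w C → Correct n ε w C
program-correct n {{n≢0}} ε {{ε>0}} ε≤1 w (ℤ.+ c)  =
  Solution.conclude n {{n≢0}} ε {{ε>0}} ε≤1 (ℤ.+ c) w (nonnegative-runs n {{n≢0}} ε {{ε>0}} ε≤1 c w)
program-correct n {{n≢0}} ε {{ε>0}} ε≤1 w -[1+ c ] =
  Solution.conclude n {{n≢0}} ε {{ε>0}} ε≤1 -[1+ c ] w (negative-runs n {{n≢0}} ε {{ε>0}} ε≤1 c w)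

theorem4 : ∃[ P ] ∃[ c ]
    ((n : ℕ) .{{_ : NonZero n}} (ε : ℚ) .{{_ : ℚ.Positive ε}} → ε ℚ.≤ 1ℚ →
    (w : Vec ℕ n) (C : ℤ) →
    ∃[ Z ] ∃[ time ]
    Computes {n} {exponentLength n} {mantissaLength n ε} P w C ε Z time
    × (1ℚ ℚ.- ε) ℚ.* fromℕ (#solutions w C) ℚ.≤ Float.value Z
    × Float.value Z ℚ.≤ fromℕ (#solutions w C)
    × fromℕ time ℚ.≤ fromℕ c ℚ.* timeBound n ε)
theorem4 = program , programCost * 4 , program-correct
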